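{- Let $G$ be a finite simple undirected graph and let $k$ be a positive integer such that $\mathrm{mad}(G) \ge k$. Then there exists $S \subseteq V(G)$ such that $G[S]$ is $(k-1)$-degenerate and $\mathrm{mad}(G - S) \le \mathrm{mad}(G) - k$. Moreover, such a set $S$ can be computed in time polynomial in the size of $G$.
   Context: For a graph $G$, $\mathrm{mad}(G) := \max_{H \subseteq G,\, V(H)\neq\emptyset} \frac{2|E(H)|}{|V(H)|}$ (the maximum average degree), where $H$ ranges over nonempty subgraphs; by convention the graph with empty vertex set has $\mathrm{mad} = -\infty$. A graph is $k$-degenerate if every subgraph has a vertex of degree at most $k$. $G[S]$ is the subgraph induced by $S$ and $G - S = G[V(G)\setminus S]$. -}

module Defs where

open import Level using (0ℓ)
open import Data.Bool.Base using (Bool; true; false)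
open import Data.Empty using (⊥; ⊥-elim)
open import Data.Fin.Base using (Fin; zero; suc; _<_)
open import Data.Fin.Properties using (_<?_)
open import Data.Fin.Subset using (Subset; _∈_; _⊆_; _∩_; _─_; ∣_∣; Nonempty)
open import Data.Fin.Subset.Properties
  using (_∈?_; x∈p∩q⁺; p∩q⊆p; p∩q⊆q; ⊆-antisym; x∈p⇒∣p-x∣<∣p∣;
         nonempty?; Empty-unique; ∣⊥∣≡0)
open import Data.Integer.Base using (+_)
open import Data.List.Base as List
  using (List; []; _∷_; foldr; map; filter; length; allFin;
         cartesianProduct; cartesianProductWith)
open import Data.List.Extrema as Extrema using ()
open import Data.List.Membership.Propositional using () renaming (_∈_ to _∈ₗ_)
open import Data.List.Membership.Propositional.Properties
  using (∈-cartesianProductWith⁺; ∈-map⁺; ∈-map⁻; ∈-cartesianProductWith⁻)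
open import Data.List.Properties using (filter-≐)
open import Data.List.Relation.Unary.Any using (here; there)
open import Data.List.Relation.Unary.All as All using ()
open import Data.Nat.Base using (ℕ; zero; suc; _+_; _*_; _≤_; pred)
open import Data.Nat.Properties using (n≮0)
open import Data.Product.Base using (∃-syntax; _×_; _,_; proj₁)
open import Data.Rational.Base as ℚ using (ℚ)
open import Data.Rational.Properties as ℚₚ using ()
open import Data.Sum.Base using (inj₁; inj₂)
open import Data.Vec.Base as Vec using (Vec; lookup; tabulate; toList; _[_]≔_)
open import Data.Vec.Properties
  using (lookup∘tabulate; []=⇒lookup; lookup⇒[]=)
open import Function.Base using (case_of_)
open import Relation.Binary.Bundles using (TotalOrder)
open import Relation.Binary.Core using (Rel)
open import Relation.Binary.Definitions using (Decidable; Symmetric; Irreflexive)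
open import Relation.Binary.PropositionalEquality
  using (_≡_; refl; sym; trans; cong; subst)
open import Relation.Nullary.Construct.Add.Infimum using (_₋; ⊥₋; [_])
open import Relation.Nullary.Decidable using (does; yes; no; _×-dec_; dec-true)
open import Relation.Binary.Construct.Add.Infimum.NonStrict ℚ._≤_
  using (_≤₋_; ≤₋-isTotalOrder-≡)

-- The vertices may be any subset of the n labels, so that subgraphs and vertex
-- deletions are again graphs on the same labels; every finite simple graph is
-- isomorphic to one with V = ⊤.
record Graph (n : ℕ) : Set₁ where
  infix 4 _~_ _~?_
  field
    V      : Subset n
    _~_    : Rel (Fin n) 0ℓ
    _~?_   : Decidable _~_
    ~-sym  : Symmetric _~_
    ~-irr  : Irreflexive _≡_ _~_
    ~⇒∈V   : ∀ {i j} → i ~ j → i ∈ V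

open Graph using (V)

infix 4 _⊆ᴳ_
record _⊆ᴳ_ {n} (H G : Graph n) : Set where
  private
    module H = Graph H
    module G = Graph G
  field
    V⊆ : H.V ⊆ G.V
    ~⇒ : ∀ {i j} → i H.~ j → i G.~ j

infix 8 _[_]ᴳ
_[_]ᴳ : ∀ {n} → Graph n → Subset n → Graph n
G [ S ]ᴳ = record
  { V     = V G ∩ S
  ; _~_   = λ i j → i ~ j × i ∈ S × j ∈ S
  ; _~?_  = λ i j → (i ~? j) ×-dec (i ∈? S) ×-dec (j ∈? S)
  ; ~-sym = λ (e , i∈S , j∈S) → ~-sym e , j∈S , i∈S
  ; ~-irr = λ i≡j (e , _) → ~-irr i≡j e
  ; ~⇒∈V  = λ (e , i∈S , _) → x∈p∩q⁺ (~⇒∈V e , i∈S)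
  }
  where open Graph G hiding (V)

infixl 7 _─ᴳ_
_─ᴳ_ : ∀ {n} → Graph n → Subset n → Graph n
G ─ᴳ S = G [ V G ─ S ]ᴳ

module _ {n} (G : Graph n) where
  open Graph G hiding (V)

  edges : List (Fin n × Fin n)
  edges = filter (λ (i , j) → (i <? j) ×-dec (i ~? j))
                 (cartesianProduct (allFin n) (allFin n))

  degree : Fin n → ℕ
  degree v = length (filter (v ~?_) (allFin n))

Degenerate : ∀ {n} → ℕ → Graph n → Set₁
Degenerate {n} k G = ∀ (H : Graph n) → H ⊆ᴳ G → Nonempty (V H) →
                     ∃[ v ] v ∈ V H × degree H v ≤ k

ratio : ℕ → ℕ → ℚ ₋
ratio a zero    = ⊥₋
ratio a (suc b) = [ + a ℚ./ suc b ]

-- -∞ on the empty graph, which therefore does not contribute to the maximum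
-- that defines mad.
averageDegree : ∀ {n} → Graph n → ℚ ₋
averageDegree H = ratio (2 * length (edges H)) ∣ V H ∣

allVecs : ∀ {A : Set} → List A → ∀ n → List (Vec A n)
allVecs xs zero    = Vec.[] ∷ []
allVecs xs (suc n) = cartesianProductWith Vec._∷_ xs (allVecs xs n)

-- Every subgraph of G arises this way, with W its vertex set and F its
-- adjacency matrix.
subgraph : ∀ {n} → Graph n → Subset n → Vec (Subset n) n → Graph n
subgraph G W F = record
  { V     = V G ∩ W
  ; _~_   = λ i j → i ~ j × (i ∈ W × j ∈ W) × (j ∈ lookup F i × i ∈ lookup F j)
  ; _~?_  = λ i j → (i ~? j) ×-dec ((i ∈? W) ×-dec (j ∈? W))
                      ×-dec ((j ∈? lookup F i) ×-dec (i ∈? lookup F j))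
  ; ~-sym = λ (e , (p , q) , (r , s)) → ~-sym e , (q , p) , (s , r)
  ; ~-irr = λ i≡j (e , _) → ~-irr i≡j e
  ; ~⇒∈V  = λ (e , (p , _) , _) → x∈p∩q⁺ (~⇒∈V e , p)
  }
  where open Graph G hiding (V)

sides : List Bool
sides = true ∷ false ∷ []

subgraphs : ∀ {n} → Graph n → List (Graph n)
subgraphs {n} G = cartesianProductWith (subgraph G)
                    (allVecs sides n) (allVecs (allVecs sides n) n)

ℚ₋-totalOrder : TotalOrder 0ℓ 0ℓ 0ℓ
ℚ₋-totalOrder = record { isTotalOrder = ≤₋-isTotalOrder-≡ ℚₚ.≤-isTotalOrder }

open Extrema ℚ₋-totalOrder using (max; xs≤max; argmax-sel)

mad : ∀ {n} → Graph n → ℚ ₋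
mad G = max ⊥₋ (map averageDegree (subgraphs G))

fromℕ : ℕ → ℚ
fromℕ k = + k ℚ./ 1

infixl 6 _-₋_
_-₋_ : ℚ ₋ → ℚ → ℚ ₋
⊥₋    -₋ q = ⊥₋
[ p ] -₋ q = [ p ℚ.- q ]

allVecs-complete : ∀ {A : Set} {xs : List A} → (∀ x → x ∈ₗ xs) →
                   ∀ {n} (v : Vec A n) → v ∈ₗ allVecs xs n
allVecs-complete all Vec.[]      = here refl
allVecs-complete all (x Vec.∷ v) =
  ∈-cartesianProductWith⁺ Vec._∷_ (all x) (allVecs-complete all v)

subgraph-⊆ : ∀ {n} (G : Graph n) W F → subgraph G W F ⊆ᴳ G
subgraph-⊆ G W F = record { V⊆ = p∩q⊆p (V G) W ; ~⇒ = proj₁ }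

averageDegree-≤-mad : ∀ {n} (G H : Graph n) → H ⊆ᴳ G → averageDegree H ≤₋ mad G
averageDegree-≤-mad {n} G H H⊆G =
  subst (_≤₋ mad G) avg≡ (All.lookup (xs≤max ⊥₋ _) (∈-map⁺ averageDegree K∈))
  where
  module G = Graph G
  module H = Graph H

  row : Fin n → Subset n
  row i = tabulate λ j → does (i H.~? j)

  F : Vec (Subset n) n
  F = tabulate row

  K : Graph n
  K = subgraph G H.V F
  module K = Graph K

  sides-complete : ∀ b → b ∈ₗ sides
  sides-complete true  = here refl
  sides-complete false = there (here refl)

  K∈ : K ∈ₗ subgraphs G
  K∈ = ∈-cartesianProductWith⁺ (subgraph G) (allVecs-complete sides-complete H.V)
         (allVecs-complete (allVecs-complete sides-complete) F)

  entry : ∀ i j → lookup (lookup F i) j ≡ does (i H.~? j)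
  entry i j = trans (cong (λ r → lookup r j) (lookup∘tabulate row i))
                    (lookup∘tabulate (λ j → does (i H.~? j)) j)

  F⁺ : ∀ {i j} → i H.~ j → j ∈ lookup F i
  F⁺ {i} {j} e = lookup⇒[]= j (lookup F i) (trans (entry i j) (dec-true (i H.~? j) e))

  F⁻ : ∀ {i j} → j ∈ lookup F i → i H.~ j
  F⁻ {i} {j} p with i H.~? j | trans (sym (entry i j)) ([]=⇒lookup p)
  ... | yes e | _ = e
  ... | no _  | ()

  to : ∀ {i j} → i H.~ j → i K.~ j
  to e = _⊆ᴳ_.~⇒ H⊆G e , (H.~⇒∈V e , H.~⇒∈V (H.~-sym e)) , (F⁺ e , F⁺ (H.~-sym e))

  edges≡ : edges K ≡ edges H
  edges≡ = filter-≐ _ _ ((λ (l , (_ , _ , (f , _))) → l , F⁻ f) , (λ (l , e) → l , to e))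
             (cartesianProduct (allFin n) (allFin n))

  V≡ : K.V ≡ H.V
  V≡ = ⊆-antisym (p∩q⊆q (V G) H.V) (λ p → x∈p∩q⁺ (_⊆ᴳ_.V⊆ H⊆G p , p))

  avg≡ : averageDegree K ≡ averageDegree H
  avg≡ rewrite edges≡ | V≡ = refl

mad-attained : ∀ {n} (G : Graph n) → Nonempty (V G) →
               ∃[ H ] H ⊆ᴳ G × Nonempty (V H) × mad G ≡ averageDegree H
mad-attained {n} G (v , v∈G) =
  case argmax-sel (λ q → q) ⊥₋ (map averageDegree (subgraphs G)) of λ where
    (inj₁ eq) → ⊥-elim (≰⊥ (nonempty⇒ G v∈G) (subst (averageDegree G ≤₋_) eq avgG≤mad))
    (inj₂ m∈) → let (H , H∈ , eq)           = ∈-map⁻ averageDegree m∈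
                    (W , F , _ , _ , H≡)    = ∈-cartesianProductWith⁻ (subgraph G)
                                                (allVecs sides n) (allVecs (allVecs sides n) n) H∈
                    H⊆G                     = subst (_⊆ᴳ G) (sym H≡) (subgraph-⊆ G W F)
                in H , H⊆G , ∃-vertex H (subst (averageDegree G ≤₋_) eq avgG≤mad) , eq
  where
  G⊆G : G ⊆ᴳ G
  G⊆G = record { V⊆ = λ p → p ; ~⇒ = λ e → e }

  avgG≤mad : averageDegree G ≤₋ mad G
  avgG≤mad = averageDegree-≤-mad G G G⊆G

  nonempty⇒ : ∀ (H : Graph n) {u} → u ∈ V H → ∃[ q ] averageDegree H ≡ [ q ]
  nonempty⇒ H {u} u∈ with ∣ V H ∣ | x∈p⇒∣p-x∣<∣p∣ u∈
  ... | zero  | lt = ⊥-elim (n≮0 lt)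
  ... | suc m | _  = _ , refl

  ≰⊥ : ∀ {x : ℚ ₋} → ∃[ q ] x ≡ [ q ] → x ≤₋ ⊥₋ → ⊥
  ≰⊥ (q , refl) ()

  ∃-vertex : ∀ H → averageDegree G ≤₋ averageDegree H → Nonempty (V H)
  ∃-vertex H le with nonempty? (V H)
  ... | yes ne = ne
  ... | no  e  = ⊥-elim (≰⊥ (nonempty⇒ G v∈G) (subst (averageDegree G ≤₋_) avg≡⊥ le))
    where
    avg≡⊥ : averageDegree H ≡ ⊥₋
    avg≡⊥ = cong (ratio (2 * length (edges H))) (trans (cong ∣_∣ (Empty-unique e)) (∣⊥∣≡0 n))

-- The model of computation is Jones's WHILE language on binary trees, with
-- every operation taking one unit of time.  Trees are immutable, hence shared
-- in memory, and each operation allocates at most one cell; for outputs of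
-- polynomial size, running time is therefore the same as on a Turing machine up
-- to a polynomial.

infixr 5 _∙_
data Tree : Set where
  nil : Tree
  _∙_ : Tree → Tree → Tree

size : Tree → ℕ
size nil     = 1
size (s ∙ t) = suc (size s + size t)

data Expr (m : ℕ) : Set where
  var   : Fin m → Expr m
  nil   : Expr m
  cons  : Expr m → Expr m → Expr m
  hd tl : Expr m → Expr m

infix  6 _:=_
infixr 5 _⨾_
data Command (m : ℕ) : Set where
  skip          : Command m
  _:=_          : Fin m → Expr m → Command m
  _⨾_           : Command m → Command m → Command m
  if_then_else_ : Expr m → Command m → Command m → Command m
  while_repeat_    : Expr m → Command m → Command m

Store : ℕ → Set
Store = Vec Tree

head tail : Tree → Tree
head nil     = nil
head (s ∙ t) = s
tail nil     = nil
tail (s ∙ t) = t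

eval : ∀ {m} → Expr m → Store m → Tree
eval (var x)    σ = lookup σ x
eval nil        σ = nil
eval (cons e f) σ = eval e σ ∙ eval f σ
eval (hd e)     σ = head (eval e σ)
eval (tl e)     σ = tail (eval e σ)

cost : ∀ {m} → Expr m → ℕ
cost (var x)    = 1
cost nil        = 1
cost (cons e f) = suc (cost e + cost f)
cost (hd e)     = suc (cost e)
cost (tl e)     = suc (cost e)

-- ⟨ c , σ ⟩⇓ σ′ [ t ] : command c, started in store σ, halts in store σ′ after
-- time t.  A test holds if its value is not nil.
infix 4 ⟨_,_⟩⇓_[_]
data ⟨_,_⟩⇓_[_] {m : ℕ} : Command m → Store m → Store m → ℕ → Set where
  ⇓skip : ∀ {σ} → ⟨ skip , σ ⟩⇓ σ [ 1 ]
  ⇓:=   : ∀ {σ x e} → ⟨ x := e , σ ⟩⇓ σ [ x ]≔ eval e σ [ suc (cost e) ]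
  ⇓⨾    : ∀ {σ σ′ σ″ c d s t} →
          ⟨ c , σ ⟩⇓ σ′ [ s ] → ⟨ d , σ′ ⟩⇓ σ″ [ t ] →
          ⟨ c ⨾ d , σ ⟩⇓ σ″ [ s + t ]
  ⇓then : ∀ {σ σ′ e c d a b t} → eval e σ ≡ a ∙ b →
          ⟨ c , σ ⟩⇓ σ′ [ t ] →
          ⟨ if e then c else d , σ ⟩⇓ σ′ [ suc (cost e) + t ]
  ⇓else : ∀ {σ σ′ e c d t} → eval e σ ≡ nil →
          ⟨ d , σ ⟩⇓ σ′ [ t ] →
          ⟨ if e then c else d , σ ⟩⇓ σ′ [ suc (cost e) + t ]
  ⇓done : ∀ {σ e c} → eval e σ ≡ nil →
          ⟨ while e repeat c , σ ⟩⇓ σ [ suc (cost e) ]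
  ⇓loop : ∀ {σ σ′ σ″ e c a b s t} → eval e σ ≡ a ∙ b →
          ⟨ c , σ ⟩⇓ σ′ [ s ] → ⟨ while e repeat c , σ′ ⟩⇓ σ″ [ t ] →
          ⟨ while e repeat c , σ ⟩⇓ σ″ [ suc (cost e) + s + t ]

-- Variable zero holds the input at the start and the output at the end.
record Program : Set where
  constructor program
  field
    {extra} : ℕ
    body    : Command (suc extra)

infix 4 _⟦_⟧⇓_[_]
_⟦_⟧⇓_[_] : Program → Tree → Tree → ℕ → Set
program {m} c ⟦ input ⟧⇓ output [ t ] =
  ∃[ σ ] ⟨ c , input Vec.∷ Vec.replicate m nil ⟩⇓ output Vec.∷ σ [ t ]

listᵀ : List Tree → Tree
listᵀ = foldr _∙_ nil

boolᵀ : Bool → Tree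
boolᵀ false = nil
boolᵀ true  = nil ∙ nil

-- Unary is harmless: k ≤ mad G forces k to be less than the order of G.
natᵀ : ℕ → Tree
natᵀ k = listᵀ (List.replicate k nil)

subsetᵀ : ∀ {n} → Subset n → Tree
subsetᵀ S = listᵀ (map boolᵀ (toList S))

graphᵀ : ∀ {n} → Graph n → Tree
graphᵀ {n} G = subsetᵀ (V G) ∙ listᵀ (map row (allFin n))
  where
  open Graph G using (_~?_)
  row : Fin n → Tree
  row i = listᵀ (map (λ j → boolᵀ (does (i ~? j))) (allFin n))

Splits : ∀ {n} → Graph n → ℕ → Subset n → Set₁
Splits G k S = S ⊆ V G
             × Degenerate (pred k) (G [ S ]ᴳ)
             × mad (G ─ᴳ S) ≤₋ mad G -₋ fromℕ k

{-# OPTIONS --safe #-}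
module Submission where

-- Every edge vu carries 2M units, which its ends share according to potentials
-- y: the share of v is M + y u − y v, clipped to [0, 2M].  Raising y v while M
-- times the load of v (its total share) exceeds y v by more than some slack is
-- a monotone process, which stops with y ≈ M * load.  If y drops by more than M
-- along an edge, then the upper end has no share in it; as there are only n
-- vertices, some level set within n * M below a given vertex is closed, in the
-- sense that all its load comes from edges inside it, so that its average
-- degree bounds y.  Hence all loads are at most about M * mad G.  Now go through
-- the vertices by decreasing potential and put a vertex into S unless k of its
-- neighbours are there already.  Then G[S] is (k-1)-degenerate, and a vertex
-- outside S loses with S at least k shares of at least M each, so the loads in
-- G - S are at most about M * (mad G - k).  The errors disappear because average
-- degrees are fractions with denominators at most n.

open import Defs
open import Data.Bool.Base using (Bool; true; false; _∧_; T)
import Data.Bool.Base as Bool using (if_then_else_)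
open import Data.Bool.Properties using (∧-zeroʳ; ¬-not)
open import Data.Fin.Base as Fin using (Fin; zero; suc; toℕ)
open import Data.Fin.Patterns using (0F; 1F; 2F; 3F; 4F)
import Data.Fin.Properties as Fin
open import Data.Fin.Subset using (Subset; _∈_; _∉_; _⊆_; _─_; ∣_∣; Nonempty)
open import Data.Fin.Subset.Properties
  using (_∈?_; ∣p∣≤n; nonempty?; x∈p∩q⁺; x∈p∩q⁻; Empty-unique; ∣⊥∣≡0; x∈p⇒∣p-x∣<∣p∣)
import Data.Integer.Base as ℤ
import Data.Integer.Properties as ℤ
open import Data.List.Base as List using (length; filter; allFin; map; cartesianProduct)
open import Data.List.Extrema ℚ₋-totalOrder using (max≤v⁺)
import Data.List.Membership.Propositional as List
open import Data.List.Membership.Propositional.Properties using (∈-map⁻; ∈-cartesianProductWith⁻)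
import Data.List.Properties as List
import Data.List.Relation.Unary.All as All
open import Data.Nat.Base
open import Data.Nat.DivMod using (_%_; [m+kn]%n≡m%n; m<n⇒m%n≡m)
open import Data.Nat.GeneralisedArithmetic using (iterate)
open import Data.Nat.Induction using (<-wellFounded)
open import Data.Nat.Properties
open import Data.Nat.Tactic.RingSolver using (solve-∀)
open import Data.Product.Base using (∃-syntax; _×_; _,_; _,′_; proj₁; proj₂)
open import Data.Rational.Base as ℚ using (ℚ; toℚᵘ)
import Data.Rational.Properties as ℚ
open import Data.Rational.Unnormalised.Base as ℚᵘ using (mkℚᵘ; *≤*)
import Data.Rational.Unnormalised.Properties as ℚᵘ
open import Data.Sum.Base using (_⊎_; inj₁; inj₂)
open import Data.Vec.Base as Vec using ([]; _∷_; lookup; tabulate; _[_]≔_)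
open import Data.Vec.Properties using ([]=⇒lookup; lookup⇒[]=; lookup∘tabulate)
open import Function.Base using (_∘_; id; case_of_)
open import Induction.WellFounded using (Acc; acc)
open import Relation.Binary.Construct.Add.Infimum.NonStrict ℚ._≤_ using (_≤₋_; ⊥₋≤_; [_]; ≤₋-trans)
open import Relation.Binary.PropositionalEquality
open import Relation.Nullary
open import Relation.Nullary.Construct.Add.Infimum using (⊥₋; [_])
open import Relation.Nullary.Decidable using (dec-true; dec-false)

open import Algebra.Properties.Semiring.Sum +-*-semiring
  using (sum; sum-cong-≗; ∑-distrib-+; ∑-comm; *-distribˡ-sum; *-distribʳ-sum)

open Graph using (V)

-- Counting in graphs

sum-mono-≤ : ∀ {n} {f g : Fin n → ℕ} → (∀ i → f i ≤ g i) → sum f ≤ sum g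
sum-mono-≤ {zero}  f≤g = z≤n
sum-mono-≤ {suc n} f≤g = +-mono-≤ (f≤g zero) (sum-mono-≤ (f≤g ∘ suc))

sum-mono-< : ∀ {n} {f g : Fin n → ℕ} → (∀ i → f i ≤ g i) → ∀ i → f i < g i → sum f < sum g
sum-mono-< f≤g zero    lt = +-mono-<-≤ lt (sum-mono-≤ (f≤g ∘ suc))
sum-mono-< f≤g (suc i) lt = +-mono-≤-< (f≤g zero) (sum-mono-< (f≤g ∘ suc) i lt)

sum≤n*c : ∀ {n} {f : Fin n → ℕ} {c} → (∀ i → f i ≤ c) → sum f ≤ n * c
sum≤n*c {zero}  f≤c = z≤n
sum≤n*c {suc n} f≤c = +-mono-≤ (f≤c zero) (sum≤n*c (f≤c ∘ suc))

bit : Bool → ℕ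
bit true  = 1
bit false = 0

bit≤1 : ∀ b → bit b ≤ 1
bit≤1 true  = ≤-refl
bit≤1 false = z≤n

card-sum : ∀ {n} (p : Subset n) → ∣ p ∣ ≡ sum (λ v → bit (lookup p v))
card-sum []          = refl
card-sum (true  ∷ p) = cong suc (card-sum p)
card-sum (false ∷ p) = card-sum p

length-filter-tabulate : ∀ {n} {A : Set} {P : A → Set} (P? : ∀ x → Dec (P x)) (f : Fin n → A) →
  length (filter P? (List.tabulate f)) ≡ sum (λ i → bit (does (P? (f i))))
length-filter-tabulate {zero}  P? f = refl
length-filter-tabulate {suc n} P? f with does (P? (f zero))
... | true  = cong suc (length-filter-tabulate P? (f ∘ suc))
... | false = length-filter-tabulate P? (f ∘ suc)

length-filter-product : ∀ {m n} {A B : Set} {P : A × B → Set} (P? : ∀ x → Dec (P x))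
  (f : Fin m → A) (g : Fin n → B) →
  length (filter P? (cartesianProduct (List.tabulate f) (List.tabulate g))) ≡
  sum (λ i → sum (λ j → bit (does (P? (f i , g j)))))
length-filter-product {zero}  P? f g = refl
length-filter-product {suc m} P? f g = begin
  length (filter P? (map (f zero ,_) (List.tabulate g) List.++ rest))
    ≡⟨ cong length (List.filter-++ P? (map (f zero ,_) (List.tabulate g)) rest) ⟩
  length (filter P? (map (f zero ,_) (List.tabulate g)) List.++ filter P? rest)
    ≡⟨ List.length-++ (filter P? (map (f zero ,_) (List.tabulate g))) ⟩
  length (filter P? (map (f zero ,_) (List.tabulate g))) + length (filter P? rest)
    ≡⟨ cong₂ _+_ (trans (cong (length ∘ filter P?) (List.map-tabulate g (f zero ,_)))
                        (length-filter-tabulate P? (λ j → f zero , g j)))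
                 (length-filter-product P? (f ∘ suc) g) ⟩
  _ ∎
  where
  open ≡-Reasoning
  rest = cartesianProduct (List.tabulate (f ∘ suc)) (List.tabulate g)

module _ {n} (G : Graph n) where
  open Graph G hiding (V)

  adjacent : Fin n → Fin n → Bool
  adjacent v u = does (v ~? u)

  volume : ℕ
  volume = sum (λ v → sum (λ u → bit (adjacent v u)))

  degree-sum : ∀ v → degree G v ≡ sum (λ u → bit (adjacent v u))
  degree-sum v = length-filter-tabulate (v ~?_) id

  adjacent-sym : ∀ v u → adjacent v u ≡ adjacent u v
  adjacent-sym v u with v ~? u | u ~? v
  ... | yes _ | yes _ = refl
  ... | no  _ | no  _ = refl
  ... | yes e | no ¬e = contradiction (~-sym e) ¬e
  ... | no ¬e | yes e = contradiction (~-sym e) ¬e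

  -- `edges` lists each edge once, with the smaller end first. Adding the transposed count therefore
  -- covers every ordered pair of adjacent vertices exactly once.
  handshake : 2 * length (edges G) ≡ volume
  handshake = begin
    2 * length (edges G)
      ≡⟨ cong (length (edges G) +_) (+-identityʳ _) ⟩
    length (edges G) + length (edges G)
      ≡⟨ cong (λ e → e + e) (length-filter-product (λ (v , u) → (v Fin.<? u) ×-dec (v ~? u)) id id) ⟩
    sum (λ v → sum (up v)) + sum (λ v → sum (up v))
      ≡⟨ cong (sum (λ v → sum (up v)) +_) (∑-comm up) ⟩
    sum (λ v → sum (up v)) + sum (λ v → sum (λ u → up u v))
      ≡⟨ sym (∑-distrib-+ (λ v → sum (up v)) _) ⟩
    sum (λ v → sum (up v) + sum (λ u → up u v))
      ≡⟨ sum-cong-≗ (λ v → sym (∑-distrib-+ (up v) _)) ⟩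
    sum (λ v → sum (λ u → up v u + up u v))
      ≡⟨ sum-cong-≗ (λ v → sum-cong-≗ (λ u → split (v Fin.<? u) (u Fin.<? v) (v ~? u) (u ~? v))) ⟩
    volume ∎
    where
    open ≡-Reasoning
    up : Fin n → Fin n → ℕ
    up v u = bit (does ((v Fin.<? u) ×-dec (v ~? u)))

    split : ∀ {v u} (v<?u : Dec (v Fin.< u)) (u<?v : Dec (u Fin.< v)) (v~?u : Dec (v ~ u)) (u~?v : Dec (u ~ v)) →
            bit (does (v<?u ×-dec v~?u)) + bit (does (u<?v ×-dec u~?v)) ≡ bit (does v~?u)
    split (yes v<u) (yes u<v) _       _       = contradiction u<v (<-asym v<u)
    split (yes _)   (no _)    (yes _) _       = refl
    split (yes _)   (no _)    (no _)  _       = refl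
    split (no _)    (yes _)   (yes _) (yes _) = refl
    split (no _)    (yes _)   (no _)  (no _)  = refl
    split (no _)    (yes _)   (yes e) (no ¬e) = contradiction (~-sym e) ¬e
    split (no _)    (yes _)   (no ¬e) (yes e) = contradiction (~-sym e) ¬e
    split (no _)    (no _)    (no _)  _       = refl
    split (no v≮u)  (no u≮v)  (yes e) _       =
      contradiction e (~-irr (Fin.toℕ-injective (≤-antisym (≮⇒≥ u≮v) (≮⇒≥ v≮u))))

-- Exchanging the order of summation transposes `t`, so twice the sum weighs every pair with
-- `t v u + t u v`. Applied to shares, it says that the loads of a graph distribute `M` units per
-- edge end.
sum-half : ∀ {n} (w t : Fin n → Fin n → ℕ) c → (∀ v u → w v u ≡ w u v) →
           (∀ v u → t v u + t u v ≡ c + c) →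
           sum (λ v → sum (λ u → w v u * t v u)) ≡ c * sum (λ v → sum (w v))
sum-half {n} w t c w-sym t+t = *-cancelˡ-≡ _ _ 2 (begin
  2 * X
    ≡⟨ cong (X +_) (+-identityʳ X) ⟩
  X + X
    ≡⟨ cong (X +_) (∑-comm (λ v u → w v u * t v u)) ⟩
  X + sum (λ v → sum (λ u → w u v * t u v))
    ≡⟨ sym (∑-distrib-+ (λ v → sum (λ u → w v u * t v u)) _) ⟩
  sum (λ v → sum (λ u → w v u * t v u) + sum (λ u → w u v * t u v))
    ≡⟨ sum-cong-≗ (λ v → sym (∑-distrib-+ (λ u → w v u * t v u) _)) ⟩
  sum (λ v → sum (λ u → w v u * t v u + w u v * t u v))
    ≡⟨ sum-cong-≗ (λ v → sum-cong-≗ (λ u → term v u)) ⟩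
  sum (λ v → sum (λ u → 2 * c * w v u))
    ≡⟨ sum-cong-≗ (λ v → sym (*-distribˡ-sum (2 * c) (w v))) ⟩
  sum (λ v → 2 * c * sum (w v))
    ≡⟨ sym (*-distribˡ-sum (2 * c) (λ v → sum (w v))) ⟩
  2 * c * sum (λ v → sum (w v))
    ≡⟨ *-assoc 2 c _ ⟩
  2 * (c * sum (λ v → sum (w v))) ∎)
  where
  open ≡-Reasoning
  X : ℕ
  X = sum (λ v → sum (λ u → w v u * t v u))

  term : ∀ v u → w v u * t v u + w u v * t u v ≡ 2 * c * w v u
  term v u = begin
    w v u * t v u + w u v * t u v ≡⟨ cong (λ x → w v u * t v u + x * t u v) (sym (w-sym v u)) ⟩
    w v u * t v u + w v u * t u v ≡⟨ sym (*-distribˡ-+ (w v u) _ _) ⟩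
    w v u * (t v u + t u v)       ≡⟨ cong (w v u *_) (t+t v u) ⟩
    w v u * (c + c)               ≡⟨ cong (λ d → w v u * (c + d)) (sym (+-identityʳ c)) ⟩
    w v u * (2 * c)               ≡⟨ *-comm (w v u) (2 * c) ⟩
    2 * c * w v u ∎

-- While no step stalls, every step adds an element, so that the set with index `j` has at least `j`
-- elements. This cannot go on for `n + 1` steps.
chain-stalls : ∀ {n} {P : ℕ → Fin n → Set} → (∀ j u → Dec (P j u)) →
               (∀ j {u} → P j u → P (suc j) u) →
               ∃[ j ] j ≤ n × (∀ u → P (suc j) u → P j u)
chain-stalls {n} {P} P? grow with search (suc n)
  where
  count : ℕ → ℕ
  count j = sum (λ u → bit (does (P? j u)))

  search : ∀ j → (∃[ i ] i < j × (∀ u → P (suc i) u → P i u)) ⊎ j ≤ count j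
  search zero    = inj₂ z≤n
  search (suc j) with search j
  ... | inj₁ (i , i<j , stall) = inj₁ (i , m<n⇒m<1+n i<j , stall)
  ... | inj₂ j≤ with Fin.all? (λ u → P? (suc j) u →-dec P? j u)
  ...   | yes stall = inj₁ (j , ≤-refl , stall)
  ...   | no ¬stall = inj₂ (≤-trans (s≤s j≤) (sum-mono-< below (proj₁ new) (strict (proj₁ new) (proj₂ new))))
    where
    new : ∃[ u ] ¬ (P (suc j) u → P j u)
    new = Fin.¬∀⟶∃¬ n _ (λ u → P? (suc j) u →-dec P? j u) ¬stall

    below : ∀ u → bit (does (P? j u)) ≤ bit (does (P? (suc j) u))
    below u with P? j u | P? (suc j) u
    ... | yes p | yes _ = ≤-refl
    ... | yes p | no ¬q = contradiction (grow j p) ¬q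
    ... | no _  | _     = z≤n

    strict : ∀ u → ¬ (P (suc j) u → P j u) → bit (does (P? j u)) < bit (does (P? (suc j) u))
    strict u ¬stall with P? j u | P? (suc j) u
    ... | yes p | _     = contradiction (λ _ → p) ¬stall
    ... | no _  | yes _ = ≤-refl
    ... | no _  | no ¬q = contradiction (λ q → contradiction q ¬q) ¬stall
... | inj₁ (j , j<1+n , stall) = j , s≤s⁻¹ j<1+n , stall
... | inj₂ le = contradiction (≤-trans le (sum≤n*c {n} (λ u → bit≤1 (does (P? (suc n) u)))))
                  (<⇒≱ (≤-reflexive (cong suc (*-identityʳ n))))

-- Average degrees as fractions

fromRatio : ∀ a b c d → ratio a (suc b) ≤₋ ratio c (suc d) → a * suc d ≤ c * suc b
fromRatio a b c d [ p≤q ] = ℤ.drop‿+≤+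
  (subst₂ ℤ._≤_ (sym (ℤ.pos-* a (suc d))) (sym (ℤ.pos-* c (suc b)))
    (ℚᵘ.drop-*≤* (ℚᵘ.≤-respˡ-≃ (ℚ.toℚᵘ-fromℚᵘ (mkℚᵘ (ℤ.+ a) b))
                 (ℚᵘ.≤-respʳ-≃ (ℚ.toℚᵘ-fromℚᵘ (mkℚᵘ (ℤ.+ c) d)) (ℚ.toℚᵘ-mono-≤ p≤q)))))

-- The subtraction is moved to the other side: `p + r ≤ q` becomes the hypothesis after
-- cross-multiplication of unnormalised fractions.
toRatio : ∀ a b c d k → suc d * (k * suc b + a) ≤ c * suc b →
          ratio a (suc b) ≤₋ ratio c (suc d) -₋ fromℕ k
toRatio a b c d k le =
  [ subst (ℚ._≤ q ℚ.- r) cancel (ℚ.+-monoˡ-≤ (ℚ.- r) (ℚ.toℚᵘ-cancel-≤ p+r≤q)) ]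
  where
  p = ℤ.+ a ℚ./ suc b
  q = ℤ.+ c ℚ./ suc d
  r = fromℕ k

  cancel : p ℚ.+ r ℚ.- r ≡ p
  cancel = trans (ℚ.+-assoc p r (ℚ.- r)) (trans (cong (p ℚ.+_) (ℚ.+-inverseʳ r)) (ℚ.+-identityʳ p))

  le′ : (a * 1 + k * suc b) * suc d ≤ c * (suc b * 1)
  le′ = subst₂ _≤_ (lhs (suc b) (suc d) k a) (cong (c *_) (sym (*-identityʳ (suc b)))) le
    where
    lhs : ∀ b d k a → d * (k * b + a) ≡ (a * 1 + k * b) * d
    lhs = solve-∀

  num : ℤ.+ a ℤ.* ℤ.+ 1 ℤ.+ ℤ.+ k ℤ.* ℤ.+ suc b ≡ ℤ.+ (a * 1 + k * suc b)
  num = cong₂ ℤ._+_ (sym (ℤ.pos-* a 1)) (sym (ℤ.pos-* k (suc b)))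

  sum≤ : mkℚᵘ (ℤ.+ a) b ℚᵘ.+ mkℚᵘ (ℤ.+ k) 0 ℚᵘ.≤ mkℚᵘ (ℤ.+ c) d
  sum≤ = *≤* (subst₂ ℤ._≤_
    (trans (ℤ.pos-* (a * 1 + k * suc b) (suc d)) (cong (ℤ._* ℤ.+ suc d) (sym num)))
    (ℤ.pos-* c (suc b * 1))
    (ℤ.+≤+ le′))

  p+r≤q : toℚᵘ (p ℚ.+ r) ℚᵘ.≤ toℚᵘ q
  p+r≤q = ℚᵘ.≤-respˡ-≃ (ℚᵘ.≃-sym (ℚᵘ.≃-trans (ℚ.toℚᵘ-homo-+ p r)
            (ℚᵘ.+-cong (ℚ.toℚᵘ-fromℚᵘ (mkℚᵘ (ℤ.+ a) b)) (ℚ.toℚᵘ-fromℚᵘ (mkℚᵘ (ℤ.+ k) 0)))))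
          (ℚᵘ.≤-respʳ-≃ (ℚᵘ.≃-sym (ℚ.toℚᵘ-fromℚᵘ (mkℚᵘ (ℤ.+ c) d))) sum≤)

mad-least : ∀ {n} (G : Graph n) {q} → (∀ H → H ⊆ᴳ G → averageDegree H ≤₋ q) → mad G ≤₋ q
mad-least {n} G {q} bound = max≤v⁺ (⊥₋≤ q) (All.tabulate below)
  where
  below : ∀ {x} → x List.∈ map averageDegree (subgraphs G) → x ≤₋ q
  below x∈ with H , H∈ , refl ← ∈-map⁻ averageDegree x∈
    with W , F , _ , _ , refl ← ∈-cartesianProductWith⁻ (subgraph G) (allVecs sides n) (allVecs (allVecs sides n) n) H∈
    = bound _ (subgraph-⊆ G W F)

-- Potentials and the splitting set

-- The truncated subtraction does the clipping at 0.
share : ∀ {n} → ℕ → (Fin n → ℕ) → Fin n → Fin n → ℕ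
share M y v u = (M + y u ∸ y v) ⊓ (M + M)

load : ∀ {n} → ℕ → (Fin n → Fin n → Bool) → (Fin n → ℕ) → Fin n → ℕ
load M a y v = sum (λ u → bit (a v u) * share M y v u)

above : ∀ {n} → (Fin n → ℕ) → (Fin n → Bool) → Fin n → Fin n → ℕ
above y S v u = bit (S u ∧ (y v <ᵇ y u))

aboveDegree : ∀ {n} → (Fin n → Fin n → Bool) → (Fin n → ℕ) → (Fin n → Bool) → Fin n → ℕ
aboveDegree a y S v = sum (λ u → bit (a v u) * above y S v u)

-- If `y v ≤ y u` and d is their difference, then `v` gets `M` plus the minimum of d and `M`, and
-- `u` gets `M ∸ d`, which is what is left of the `M + M` units.
share-complement : ∀ {n} M (y : Fin n → ℕ) v u → share M y v u + share M y u v ≡ M + M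
share-complement M y v u = case ≤-total (y v) (y u) of λ where
    (inj₁ v≤u) → complement v u v≤u
    (inj₂ u≤v) → trans (+-comm (share M y v u) _) (complement u v u≤v)
  where
  complement : ∀ v u → y v ≤ y u → share M y v u + share M y u v ≡ M + M
  complement v u v≤u = begin
    (M + y u ∸ y v) ⊓ (M + M) + (M + y v ∸ y u) ⊓ (M + M)
      ≡⟨ cong₂ (λ s t → s ⊓ (M + M) + t ⊓ (M + M)) (+-∸-assoc M v≤u) eq ⟩
    (M + (y u ∸ y v)) ⊓ (M + M) + (M ∸ (y u ∸ y v)) ⊓ (M + M)
      ≡⟨ cong₂ _+_ (sym (+-distribˡ-⊓ M (y u ∸ y v) M)) (m≤n⇒m⊓n≡m (≤-trans (m∸n≤m M (y u ∸ y v)) (m≤m+n M M))) ⟩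
    M + (y u ∸ y v) ⊓ M + (M ∸ (y u ∸ y v))
      ≡⟨ +-assoc M _ _ ⟩
    M + ((y u ∸ y v) ⊓ M + (M ∸ (y u ∸ y v)))
      ≡⟨ cong (M +_) (m⊓n+n∸m≡n (y u ∸ y v) M) ⟩
    M + M ∎
    where
    open ≡-Reasoning
    eq : M + y v ∸ y u ≡ M ∸ (y u ∸ y v)
    eq = trans (cong₂ _∸_ (+-comm M (y v)) (sym (m+[n∸m]≡n v≤u))) ([m+n]∸[m+o]≡n∸o (y v) M _)

share-balance : ∀ {n} M (y : Fin n → ℕ) {v u} → y v ≤ y u → M ≤ share M y v u
share-balance M y {v} {u} v≤u =
  ⊓-glb (≤-trans (m≤m+n M (y u ∸ y v)) (≤-reflexive (sym (+-∸-assoc M v≤u)))) (m≤m+n M M)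

share-none : ∀ {n} M (y : Fin n → ℕ) {v u} → M + y u ≤ y v → share M y v u ≡ 0
share-none M y v≥ = cong (_⊓ (M + M)) (m≤n⇒m∸n≡0 v≥)

∈tabulate⁺ : ∀ {n} {f : Fin n → Bool} {v} → f v ≡ true → v ∈ tabulate f
∈tabulate⁺ {f = f} {v} eq = lookup⇒[]= v (tabulate f) (trans (lookup∘tabulate f v) eq)

∈tabulate⁻ : ∀ {n} {f : Fin n → Bool} {v} → v ∈ tabulate f → f v ≡ true
∈tabulate⁻ {f = f} {v} v∈ = trans (sym (lookup∘tabulate f v)) ([]=⇒lookup v∈)

does≡true⇒ : ∀ {P : Set} (p? : Dec P) → does p? ≡ true → P
does≡true⇒ (yes p) _ = p

weigh : ∀ b {m n o} → (b ≡ true → m ≤ n + o) → bit b * m ≤ n + bit b * o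
weigh true  {m} {n} {o} m≤ =
  subst₂ (λ x y → x ≤ n + y) (sym (+-identityʳ m)) (sym (+-identityʳ o)) (m≤ refl)
weigh false m≤ = z≤n

x∈p─q⇒x∉q : ∀ {n} (p q : Subset n) {x} → x ∈ p ─ q → x ∉ q
x∈p─q⇒x∉q (true ∷ p) (true  ∷ q) () Vec.here
x∈p─q⇒x∉q (false ∷ p) (true  ∷ q) () Vec.here
x∈p─q⇒x∉q (_ ∷ p) (true ∷ q) (Vec.there x∈) (Vec.there x∈q) = x∈p─q⇒x∉q p q x∈ x∈q
x∈p─q⇒x∉q (_ ∷ p) (false ∷ q) (Vec.there x∈) (Vec.there x∈q) = x∈p─q⇒x∉q p q x∈ x∈q

minimal : ∀ {n} {P : Fin n → Set} → (∀ v → Dec (P v)) → (y : Fin n → ℕ) → ∀ v → P v →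
          ∃[ w ] P w × (∀ u → P u → y w ≤ y u)
minimal {P = P} P? y v Pv = search v Pv (<-wellFounded (y v))
  where
  search : ∀ v → P v → Acc _<_ (y v) → ∃[ w ] P w × (∀ u → P u → y w ≤ y u)
  search v Pv (acc rec) with Fin.any? (λ u → P? u ×-dec (y u <? y v))
  ... | yes (u , Pu , u<v) = search u Pu (rec u<v)
  ... | no ¬∃              = v , Pv , λ u Pu → ≮⇒≥ (λ u<v → ¬∃ (u , Pu , u<v))

module _ {n} (H : Graph n) where
  open Graph H hiding (V)

  adjacent⁺ : ∀ {v u} → v ~ u → adjacent H v u ≡ true
  adjacent⁺ {v} {u} e = dec-true (v ~? u) e

  nonadjacent : ∀ {v u} → ¬ v ~ u → adjacent H v u ≡ false
  nonadjacent {v} {u} ¬e = dec-false (v ~? u) ¬e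

  averageDegree-volume : averageDegree H ≡ ratio (volume H) ∣ V H ∣
  averageDegree-volume = cong (λ e → ratio e ∣ V H ∣) (handshake H)

  load-sum : ∀ M y → sum (load M (adjacent H) y) ≡ M * volume H
  load-sum M y = sum-half (λ v u → bit (adjacent H v u)) (share M y) M
                   (λ v u → cong bit (adjacent-sym H v u)) (share-complement M y)

  load-outside : ∀ M y {v} → v ∉ V H → load M (adjacent H) y v ≡ 0
  load-outside M y {v} v∉ = n≤0⇒n≡0 (≤-trans (sum≤n*c {n} {c = 0} (λ u →
      ≤-reflexive (cong (λ b → bit b * share M y v u) (nonadjacent (λ e → v∉ (~⇒∈V e))))))
    (≤-reflexive (*-zeroʳ n)))

∈⇒∣p∣≡suc : ∀ {n} {p : Subset n} {v} → v ∈ p → ∃[ m ] ∣ p ∣ ≡ suc m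
∈⇒∣p∣≡suc {p = p} v∈p with ∣ p ∣ | x∈p⇒∣p-x∣<∣p∣ v∈p
... | suc m | _ = m , refl

induced-⊆ : ∀ {n} (G : Graph n) S → G [ S ]ᴳ ⊆ᴳ G
induced-⊆ G S = record { V⊆ = λ v∈ → proj₁ (x∈p∩q⁻ _ _ v∈) ; ~⇒ = proj₁ }

nonempty-if-mad≥ : ∀ {n} (G : Graph n) {q} → [ q ] ≤₋ mad G → Nonempty (V G)
nonempty-if-mad≥ {n} G {q} q≤mad with nonempty? (V G)
... | yes ne = ne
... | no ¬ne = contradiction (≤₋-trans ℚ.≤-trans q≤mad (mad-least G below)) λ ()
  where
  below : ∀ H → H ⊆ᴳ G → averageDegree H ≤₋ ⊥₋
  below H H⊆G with ∣ V H ∣ | trans (cong ∣_∣ (Empty-unique (λ (v , v∈) → ¬ne (v , _⊆ᴳ_.V⊆ H⊆G v∈)))) (∣⊥∣≡0 n)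
  ... | zero | _ = ⊥₋≤ ⊥₋

-- `quiet` and `supported` make `y` a fixed point of `M * load` up to the errors `s₁` and `s₂`. As
-- there are no ties, `greedy` describes the outcome of going through the vertices by decreasing
-- potential. `fine` keeps the accumulated error below one unit of `M * M`.
module _ {n} (G : Graph n) (k : ℕ) .{{_ : NonZero k}} (M s₁ s₂ : ℕ) (y : Fin n → ℕ) (S : Fin n → Bool)
  (quiet : ∀ v → M * load M (adjacent G) y v < y v + s₁)
  (supported : ∀ v → y v ≤ M * load M (adjacent G) y v + s₂)
  (y-injective : ∀ {u v} → y u ≡ y v → u ≡ v)
  (greedy : ∀ v → S v ≡ lookup (V G) v ∧ (aboveDegree (adjacent G) y S v <ᵇ k))
  (fine : n * (n * (s₂ + n * M + s₁)) < M * M)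
  where

  open Graph G hiding (V)

  private
    S⊆V : tabulate S ⊆ V G
    S⊆V {v} v∈S with lookup (V G) v in eq | trans (sym (greedy v)) (∈tabulate⁻ v∈S)
    ... | true | _ = lookup⇒[]= v (V G) eq

    few-above : ∀ {v} → S v ≡ true → aboveDegree (adjacent G) y S v < k
    few-above {v} v∈S with lookup (V G) v | trans (sym (greedy v)) v∈S
    ... | true | eq = <ᵇ⇒< _ k (subst T (sym eq) _)

    many-above : ∀ {v} → v ∈ V G → S v ≡ false → k ≤ aboveDegree (adjacent G) y S v
    many-above {v} v∈V v∉S =
      ≮⇒≥ λ lt → case trans (sym v∉S) (trans (greedy v) (cong₂ _∧_ ([]=⇒lookup v∈V) (T⇒≡true (<⇒<ᵇ lt)))) of λ ()
      where
      T⇒≡true : ∀ {b} → T b → b ≡ true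
      T⇒≡true {true} _ = refl

    -- The vertex of `H` with the least potential works: its neighbours in `H` lie in `S` and have
    -- strictly larger potential, and when it was put into `S` there were fewer than `k` of those.
    degenerate : Degenerate (pred k) (G [ tabulate S ]ᴳ)
    degenerate H H⊆ (v₀ , v₀∈) =
      let v , v∈ , least = minimal (_∈? V H) y v₀ v₀∈ in
      v , v∈ , ≤-trans (≤-trans (≤-reflexive (degree-sum H v)) (sum-mono-≤ (counted v v∈ least)))
                       (<⇒≤pred (few-above (∈tabulate⁻ (proj₂ (x∈p∩q⁻ _ _ (_⊆ᴳ_.V⊆ H⊆ v∈))))))
      where
      module H = Graph H
      counted : ∀ v → v ∈ V H → (∀ u → u ∈ V H → y v ≤ y u) → ∀ u →
                bit (adjacent H v u) ≤ bit (adjacent G v u) * above y S v u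
      counted v v∈ least u with v H.~? u
      ... | no _  = z≤n
      ... | yes e = let e′ , v∈S , u∈S = _⊆ᴳ_.~⇒ H⊆ e in ≤-reflexive (sym (cong₂ (λ a b → bit a * bit b)
        (adjacent⁺ G e′)
        (cong₂ _∧_ (∈tabulate⁻ u∈S)
          (dec-true (y v <? y u) (≤∧≢⇒< (least u (H.~⇒∈V (H.~-sym e))) (λ eq → ~-irr (y-injective eq) e′))))))

    -- The fraction of `A` and `suc B` stands for mad G. It will be the unreduced average degree of
    -- a densest subgraph, so that `suc B` is an order and hence at most `n`.
    module _ {B A : ℕ} (B≤n : suc B ≤ n)
      (densest : ∀ H → H ⊆ᴳ G → Nonempty (V H) → volume H * suc B ≤ A * ∣ V H ∣) where

      -- The level sets below `v`, in steps of `M`: one step is the drop in potential at which the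
      -- upper end of an edge has no share left.
      Near : Fin n → ℕ → Fin n → Set
      Near v j u = u ∈ V G × y v ≤ y u + j * M

      near? : ∀ v j u → Dec (Near v j u)
      near? v j u = (u ∈? V G) ×-dec (y v ≤? y u + j * M)

      -- All potentials in the stalled level set `R` are at least `y v` up to `n * M`, and by
      -- `supported` each is at most `M` times a load up to `s₂`. As `R` is closed, these loads are
      -- covered by the loads within `R`, whose sum is `M * volume R`; averaging over `R` and using
      -- `densest` gives the bound.
      potential-bound-stalled : ∀ {v} → v ∈ V G → ∀ j → j ≤ n → (∀ u → Near v (suc j) u → Near v j u) →
                                suc B * y v ≤ M * M * A + suc B * (s₂ + n * M)
      potential-bound-stalled {v} v∈V j j≤n stalled =
        *-cancelˡ-≤ ∣ V R ∣ {{subst NonZero (sym (proj₂ positive)) _}} (begin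
        ∣ V R ∣ * (suc B * y v)
          ≡⟨ swap ∣ V R ∣ (suc B) (y v) ⟩
        suc B * (∣ V R ∣ * y v)
          ≤⟨ *-monoʳ-≤ (suc B) summed ⟩
        suc B * (M * (M * volume R) + ∣ V R ∣ * (s₂ + n * M))
          ≡⟨ rearrange (suc B) M (volume R) ∣ V R ∣ (s₂ + n * M) ⟩
        M * M * (volume R * suc B) + ∣ V R ∣ * (suc B * (s₂ + n * M))
          ≤⟨ +-monoˡ-≤ _ (*-monoʳ-≤ (M * M) (densest R (induced-⊆ G _) (v , v∈R))) ⟩
        M * M * (A * ∣ V R ∣) + ∣ V R ∣ * (suc B * (s₂ + n * M))
          ≡⟨ collect (M * M) A ∣ V R ∣ (suc B * (s₂ + n * M)) ⟩
        ∣ V R ∣ * (M * M * A + suc B * (s₂ + n * M)) ∎)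
        where
        open ≤-Reasoning

        swap : ∀ r b y → r * (b * y) ≡ b * (r * y)
        swap = solve-∀
        rearrange : ∀ b m w r c → b * (m * (m * w) + r * c) ≡ m * m * (w * b) + r * (b * c)
        rearrange = solve-∀
        collect : ∀ m a r c → m * (a * r) + r * c ≡ r * (m * a + c)
        collect = solve-∀

        R : Graph n
        R = G [ tabulate (λ u → does (near? v j u)) ]ᴳ

        R⁺ : ∀ {u} → Near v j u → u ∈ tabulate (λ u → does (near? v j u))
        R⁺ {u} p = ∈tabulate⁺ (dec-true (near? v j u) p)

        R⁻ : ∀ {u} → u ∈ tabulate (λ u → does (near? v j u)) → Near v j u
        R⁻ {u} u∈ = does≡true⇒ (near? v j u) (∈tabulate⁻ u∈)

        v∈R : v ∈ V R
        v∈R = x∈p∩q⁺ (v∈V , R⁺ (v∈V , m≤m+n (y v) _))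

        positive : ∃[ m ] ∣ V R ∣ ≡ suc m
        positive = ∈⇒∣p∣≡suc v∈R

        -- A neighbour `w` outside the level set is not in the next one either, since the chain
        -- stalls. So it lies more than `M` below `u`, and `u` has no share in the edge.
        closed : ∀ {u} → Near v j u → ∀ w → bit (adjacent G u w) * share M y u w ≤ bit (adjacent R u w) * share M y u w
        closed {u} pu w = case (u ~? w) ,′ near? v j w of λ where
            (no ¬e , _)      → ≤-trans (≤-reflexive (cong (λ b → bit b * share M y u w) (nonadjacent G ¬e))) z≤n
            (yes e , yes pw) → ≤-reflexive (cong (λ b → bit b * share M y u w)
                                 (trans (adjacent⁺ G e) (sym (adjacent⁺ R (e , R⁺ pu , R⁺ pw)))))
            (yes e , no ¬pw) → ≤-trans (≤-reflexive (trans (cong (bit (adjacent G u w) *_) (share-none M y (far e ¬pw)))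
                                                           (*-zeroʳ (bit (adjacent G u w))))) z≤n
          where
          far : u ~ w → ¬ Near v j w → M + y w ≤ y u
          far e ¬pw = +-cancelʳ-≤ (j * M) _ _ (≤-trans
            (≤-reflexive (trans (cong (_+ j * M) (+-comm M (y w))) (+-assoc (y w) M (j * M))))
            (≤-trans (<⇒≤ (≰⇒> λ le → ¬pw (stalled w (~⇒∈V (~-sym e) , le)))) (proj₂ pu)))

        pointwise : ∀ u → bit (lookup (V R) u) * y v ≤ M * load M (adjacent R) y u + bit (lookup (V R) u) * (s₂ + n * M)
        pointwise u = weigh (lookup (V R) u) λ eq →
          let pu = R⁻ (proj₂ (x∈p∩q⁻ _ _ (lookup⇒[]= u (V R) eq))) in begin
          y v
            ≤⟨ proj₂ pu ⟩
          y u + j * M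
            ≤⟨ +-mono-≤ (supported u) (*-monoˡ-≤ M j≤n) ⟩
          M * load M (adjacent G) y u + s₂ + n * M
            ≤⟨ +-monoˡ-≤ (n * M) (+-monoˡ-≤ s₂ (*-monoʳ-≤ M (sum-mono-≤ (closed pu)))) ⟩
          M * load M (adjacent R) y u + s₂ + n * M
            ≡⟨ +-assoc (M * load M (adjacent R) y u) s₂ (n * M) ⟩
          M * load M (adjacent R) y u + (s₂ + n * M) ∎

        summed : ∣ V R ∣ * y v ≤ M * (M * volume R) + ∣ V R ∣ * (s₂ + n * M)
        summed = begin
          ∣ V R ∣ * y v
            ≡⟨ cong (_* y v) (card-sum (V R)) ⟩
          sum r * y v
            ≡⟨ *-distribʳ-sum (y v) r ⟩
          sum (λ u → r u * y v)
            ≤⟨ sum-mono-≤ pointwise ⟩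
          sum (λ u → M * load M (adjacent R) y u + r u * (s₂ + n * M))
            ≡⟨ ∑-distrib-+ (λ u → M * load M (adjacent R) y u) _ ⟩
          sum (λ u → M * load M (adjacent R) y u) + sum (λ u → r u * (s₂ + n * M))
            ≡⟨ sym (cong₂ _+_ (*-distribˡ-sum M (load M (adjacent R) y)) (*-distribʳ-sum (s₂ + n * M) r)) ⟩
          M * sum (load M (adjacent R) y) + sum r * (s₂ + n * M)
            ≡⟨ cong₂ (λ l c → M * l + c * (s₂ + n * M)) (load-sum R M y) (sym (card-sum (V R))) ⟩
          M * (M * volume R) + ∣ V R ∣ * (s₂ + n * M) ∎
          where
          r : Fin n → ℕ
          r u = bit (lookup (V R) u)

      potential-bound : ∀ {v} → v ∈ V G → suc B * y v ≤ M * M * A + suc B * (s₂ + n * M)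
      potential-bound {v} v∈V =
        let j , j≤n , stalled = chain-stalls (near? v)
              (λ j (u∈ , le) → u∈ , ≤-trans le (+-monoʳ-≤ _ (m≤n+m (j * M) M))) in
        potential-bound-stalled v∈V j j≤n stalled

      -- A failure would be by at least one unit of M * M, as all quantities are
      -- integers, whereas the errors sum up to less than M * M by fine.
      sparse : ∀ H → H ⊆ᴳ G ─ᴳ tabulate S → suc B * (k * ∣ V H ∣ + volume H) ≤ A * ∣ V H ∣
      sparse H H⊆ = ≮⇒≥ λ dense → <⇒≱ fine (begin
        M * M
          ≤⟨ +-cancelˡ-≤ (M * M * (A * ∣ V H ∣)) _ _ (begin
            M * M * (A * ∣ V H ∣) + M * M
              ≡⟨ trans (+-comm _ (M * M)) (sym (*-suc (M * M) (A * ∣ V H ∣))) ⟩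
            M * M * suc (A * ∣ V H ∣)
              ≤⟨ *-monoʳ-≤ (M * M) dense ⟩
            M * M * (suc B * (k * ∣ V H ∣ + volume H))
              ≡⟨ expand (suc B) M k ∣ V H ∣ (volume H) ⟩
            ∣ V H ∣ * (suc B * (M * (M * k))) + suc B * M * (M * volume H)
              ≤⟨ summed ⟩
            ∣ V H ∣ * C
              ≡⟨ collect ∣ V H ∣ (M * M) A (suc B) (s₂ + n * M) s₁ ⟩
            M * M * (A * ∣ V H ∣) + ∣ V H ∣ * (suc B * (s₂ + n * M + s₁)) ∎) ⟩
        ∣ V H ∣ * (suc B * (s₂ + n * M + s₁))
          ≤⟨ *-mono-≤ (∣p∣≤n (V H)) (*-monoˡ-≤ (s₂ + n * M + s₁) B≤n) ⟩
        n * (n * (s₂ + n * M + s₁)) ∎)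
        where
        open ≤-Reasoning
        module H = Graph H
        -- `C` bounds `suc B * (M * load)` at every vertex of `G`: it is the bound on potentials
        -- plus the error from `quiet`.
        C : ℕ
        C = M * M * A + suc B * (s₂ + n * M) + suc B * s₁
        expand : ∀ b m k h w → m * m * (b * (k * h + w)) ≡ h * (b * (m * (m * k))) + b * m * (m * w)
        expand = solve-∀
        collect : ∀ h m a b c s → h * (m * a + b * c + b * s) ≡ m * (a * h) + h * (b * (c + s))
        collect = solve-∀
        factor : ∀ b m k l → 1 * (b * (m * (m * k))) + b * m * l ≡ b * (m * (m * k + l))
        factor = solve-∀

        avoids : ∀ {u} → u ∈ V H → u ∈ V G × S u ≡ false
        avoids {u} u∈ = let u∈V , u∈V─S = x∈p∩q⁻ _ _ (_⊆ᴳ_.V⊆ H⊆ u∈) in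
          u∈V , ¬-not (λ u∈S → x∈p─q⇒x∉q (V G) (tabulate S) u∈V─S (∈tabulate⁺ u∈S))

        -- An edge of `H` ends outside `S` and keeps its share. Any other edge of `G` may be lost,
        -- and if it leads to a vertex of `S` with larger potential, then by `share-balance` at
        -- least `M` units are lost with it.
        term : ∀ v u → M * (bit (adjacent G v u) * above y S v u) + bit (adjacent H v u) * share M y v u
                       ≤ bit (adjacent G v u) * share M y v u
        term v u with v H.~? u
        ... | yes e = ≤-reflexive (trans
          (cong₂ (λ b c → M * (bit b * bit (c ∧ (y v <ᵇ y u))) + 1 * share M y v u)
                 (adjacent⁺ G e′) (proj₂ (avoids (H.~⇒∈V (H.~-sym e)))))
          (trans (cong (_+ 1 * share M y v u) (*-zeroʳ M))
                 (cong (λ b → bit b * share M y v u) (sym (adjacent⁺ G e′)))))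
          where e′ = proj₁ (_⊆ᴳ_.~⇒ H⊆ e)
        ... | no _ with adjacent G v u | S u
        ...   | false | _     = ≤-reflexive (trans (+-identityʳ (M * 0)) (*-zeroʳ M))
        ...   | true  | false = ≤-trans (≤-reflexive (trans (+-identityʳ (M * 0)) (*-zeroʳ M))) z≤n
        ...   | true  | true  with y v <? y u
        ...     | yes v<u = ≤-trans (≤-reflexive (trans (+-identityʳ _)
                              (trans (cong (λ b → M * (bit b + 0)) (dec-true (y v <? y u) v<u)) (*-identityʳ M))))
                              (≤-trans (share-balance M y (<⇒≤ v<u)) (≤-reflexive (sym (+-identityʳ _))))
        ...     | no v≮u  = ≤-trans (≤-reflexive (trans (+-identityʳ _)
                              (trans (cong (λ b → M * (bit b + 0)) (dec-false (y v <? y u) v≮u)) (*-zeroʳ M)))) z≤n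

        -- A vertex of `H` was refused by the greedy choice, so at least `k` edges to higher
        -- vertices of `S` are lost.
        drop : ∀ {v} → v ∈ V H → M * k + load M (adjacent H) y v ≤ load M (adjacent G) y v
        drop {v} v∈ = begin
          M * k + load M (adjacent H) y v
            ≤⟨ +-monoˡ-≤ _ (*-monoʳ-≤ M (many-above (proj₁ (avoids v∈)) (proj₂ (avoids v∈)))) ⟩
          M * aboveDegree (adjacent G) y S v + load M (adjacent H) y v
            ≡⟨ cong (_+ load M (adjacent H) y v) (*-distribˡ-sum M (λ u → bit (adjacent G v u) * above y S v u)) ⟩
          sum (λ u → M * (bit (adjacent G v u) * above y S v u)) + load M (adjacent H) y v
            ≡⟨ sym (∑-distrib-+ (λ u → M * (bit (adjacent G v u) * above y S v u)) _) ⟩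
          sum (λ u → M * (bit (adjacent G v u) * above y S v u) + bit (adjacent H v u) * share M y v u)
            ≤⟨ sum-mono-≤ (term v) ⟩
          load M (adjacent G) y v ∎

        pointwise : ∀ v → bit (lookup (V H) v) * (suc B * (M * (M * k))) + suc B * M * load M (adjacent H) y v
                          ≤ bit (lookup (V H) v) * C
        pointwise v with v ∈? V H
        ... | no v∉ = ≤-trans (≤-reflexive (cong₂ (λ b l → bit b * (suc B * (M * (M * k))) + suc B * M * l)
                                 (¬-not (λ eq → v∉ (lookup⇒[]= v (V H) eq))) (load-outside H M y v∉)))
                        (≤-trans (≤-reflexive (*-zeroʳ (suc B * M))) z≤n)
        ... | yes v∈ = begin
          bit (lookup (V H) v) * (suc B * (M * (M * k))) + suc B * M * load M (adjacent H) y v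
            ≡⟨ cong (λ b → bit b * (suc B * (M * (M * k))) + suc B * M * load M (adjacent H) y v) ([]=⇒lookup v∈) ⟩
          1 * (suc B * (M * (M * k))) + suc B * M * load M (adjacent H) y v
            ≡⟨ factor (suc B) M k (load M (adjacent H) y v) ⟩
          suc B * (M * (M * k + load M (adjacent H) y v))
            ≤⟨ *-monoʳ-≤ (suc B) (*-monoʳ-≤ M (drop v∈)) ⟩
          suc B * (M * load M (adjacent G) y v)
            ≤⟨ *-monoʳ-≤ (suc B) (<⇒≤ (quiet v)) ⟩
          suc B * (y v + s₁)
            ≡⟨ *-distribˡ-+ (suc B) (y v) s₁ ⟩
          suc B * y v + suc B * s₁
            ≤⟨ +-monoˡ-≤ (suc B * s₁) (potential-bound (proj₁ (avoids v∈))) ⟩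
          C
            ≡⟨ sym (*-identityˡ C) ⟩
          1 * C
            ≡⟨ cong (λ b → bit b * C) (sym ([]=⇒lookup v∈)) ⟩
          bit (lookup (V H) v) * C ∎

        summed : ∣ V H ∣ * (suc B * (M * (M * k))) + suc B * M * (M * volume H) ≤ ∣ V H ∣ * C
        summed = begin
          ∣ V H ∣ * X + suc B * M * (M * volume H)
            ≡⟨ cong₂ (λ c l → c * X + suc B * M * l) (card-sum (V H)) (sym (load-sum H M y)) ⟩
          sum h * X + suc B * M * sum (load M (adjacent H) y)
            ≡⟨ cong₂ _+_ (*-distribʳ-sum X h) (*-distribˡ-sum (suc B * M) (load M (adjacent H) y)) ⟩
          sum (λ v → h v * X) + sum (λ v → suc B * M * load M (adjacent H) y v)
            ≡⟨ sym (∑-distrib-+ (λ v → h v * X) _) ⟩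
          sum (λ v → h v * X + suc B * M * load M (adjacent H) y v)
            ≤⟨ sum-mono-≤ pointwise ⟩
          sum (λ v → h v * C)
            ≡⟨ sym (*-distribʳ-sum C h) ⟩
          sum h * C
            ≡⟨ cong (_* C) (sym (card-sum (V H))) ⟩
          ∣ V H ∣ * C ∎
          where
          X : ℕ
          X = suc B * (M * (M * k))
          h : Fin n → ℕ
          h v = bit (lookup (V H) v)

    module _ {B A : ℕ} (B≤n : suc B ≤ n) (mad≡ : mad G ≡ ratio A (suc B)) where

      densest : ∀ H → H ⊆ᴳ G → Nonempty (V H) → volume H * suc B ≤ A * ∣ V H ∣
      densest H H⊆G (v , v∈)
        with ∣ V H ∣ | ∈⇒∣p∣≡suc v∈ | subst₂ _≤₋_ (averageDegree-volume H) mad≡ (averageDegree-≤-mad G H H⊆G)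
      ... | suc m | _ | le = fromRatio (volume H) m A B le

      mad-drops : mad (G ─ᴳ tabulate S) ≤₋ mad G -₋ fromℕ k
      mad-drops = mad-least (G ─ᴳ tabulate S) λ H H⊆ →
          subst₂ (λ p q → p ≤₋ q -₋ fromℕ k) (sym (averageDegree-volume H)) (sym mad≡)
            (below (volume H) ∣ V H ∣ (sparse {B} {A} B≤n densest H H⊆))
        where
        below : ∀ e h → suc B * (k * h + e) ≤ A * h → ratio e h ≤₋ ratio A (suc B) -₋ fromℕ k
        below e zero    _  = ⊥₋≤ _
        below e (suc h) le = toRatio e h A B k le

  splits : [ fromℕ k ] ≤₋ mad G → Splits G k (tabulate S)
  splits k≤mad =
    let D , _ , (_ , v∈D) , mad≡ = mad-attained G (nonempty-if-mad≥ G k≤mad)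
        B , ∣D∣≡ = ∈⇒∣p∣≡suc v∈D
    in S⊆V , degenerate ,
       mad-drops {B} {volume D} (subst (_≤ n) ∣D∣≡ (∣p∣≤n (V D)))
                 (trans mad≡ (trans (averageDegree-volume D) (cong (ratio (volume D)) ∣D∣≡)))

-- A programming language whose terms all run in polynomial time

iterate-+ : ∀ {A : Set} (f : A → A) x m n → iterate f x (m + n) ≡ iterate f (iterate f x m) n
iterate-+ f x zero    n = refl
iterate-+ f x (suc m) n = iterate-+ f (f x) m n

iterate-suc : ∀ {A : Set} (f : A → A) x n → iterate f x (suc n) ≡ f (iterate f x n)
iterate-suc f x zero    = refl
iterate-suc f x (suc n) = iterate-suc f (f x) n

-- rep i j t u iterates u, whose variable zero is the accumulator, from t on.
-- It does so ℓ ^ j times, where ℓ is the length of a fixed list, the clock,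
-- without its first i elements.  Every term therefore runs in polynomial time.
data Term (m : ℕ) : Set where
  ret  : Expr m → Term m
  cond : Expr m → Term m → Term m → Term m
  rep  : ℕ → ℕ → Term m → Term (suc m) → Term m

spine : Tree → ℕ
spine nil     = 0
spine (_ ∙ t) = suc (spine t)

tails : ℕ → Tree → Tree
tails i t = iterate tail t i

ifᵀ : ∀ {A : Set} → Tree → A → A → A
ifᵀ nil     x y = y
ifᵀ (_ ∙ _) x y = x

⟦_⟧ : ∀ {m} → Term m → Tree → Store m → Tree
⟦ ret e ⟧       C ρ = eval e ρ
⟦ cond e t u ⟧  C ρ = ifᵀ (eval e ρ) (⟦ t ⟧ C ρ) (⟦ u ⟧ C ρ)
⟦ rep i j t u ⟧ C ρ = iterate (λ a → ⟦ u ⟧ C (a ∷ ρ)) (⟦ t ⟧ C ρ) (spine (tails i C) ^ j)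

-- Compilation into WHILE commands

envᵀ : ∀ {m} → Store m → Tree
envᵀ []      = nil
envᵀ (x ∷ ρ) = x ∙ envᵀ ρ

result env stack clock : Fin 4
result = zero
env    = suc zero
stack  = suc (suc zero)
clock  = suc (suc (suc zero))

tlⁿ : ∀ {m} → ℕ → Expr m → Expr m
tlⁿ zero    e = e
tlⁿ (suc i) e = tlⁿ i (tl e)

fromEnv : ∀ {m} → Fin m → Expr 4 → Expr 4
fromEnv zero    e = hd e
fromEnv (suc x) e = fromEnv x (tl e)

compileExpr : ∀ {m} → Expr m → Expr 4
compileExpr (var x)    = fromEnv x (var env)
compileExpr nil        = nil
compileExpr (cons e f) = cons (compileExpr e) (compileExpr f)
compileExpr (hd e)     = hd (compileExpr e)
compileExpr (tl e)     = tl (compileExpr e)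

ticks : ℕ → Expr 4
ticks i = tlⁿ i (var clock)

-- The registers hold the value computed last, the list of the values of the
-- variables, the rests of the clock for the loops under way, and the clock.
loop : ℕ → ℕ → Command 4 → Command 4
loop i zero    c = env := cons (var result) (var env) ⨾ c ⨾ env := tl (var env)
loop i (suc j) c =
  stack := cons (ticks i) (var stack) ⨾
  (while hd (var stack) repeat
    (stack := cons (tl (hd (var stack))) (tl (var stack)) ⨾ loop i j c)) ⨾
  stack := tl (var stack)

compile : ∀ {m} → Term m → Command 4
compile (ret e)       = result := compileExpr e
compile (cond e t u)  = if compileExpr e then compile t else compile u
compile (rep i j t u) = compile t ⨾ loop i j (compile u)

-- Pushing the accumulator onto `env` takes 4 and popping it 3. A round of the `while` takes 3 for
-- the test and 7 for advancing the clock, besides its body; the last test and the final pop take 3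
-- each. The number of rounds is bounded by `b`.
loopTime : ℕ → ℕ → ℕ → ℕ → ℕ
loopTime i zero    b T = 4 + (T + 3)
loopTime i (suc j) b T = suc (cost (cons (ticks i) (var (stack)))) + ((b * (10 + loopTime i j b T) + 3) + 3)

time : ∀ {m} → Term m → ℕ → ℕ
time (ret e)       b = suc (cost (compileExpr e))
time (cond e t u)  b = suc (cost (compileExpr e)) + (time t b + time u b)
time (rep i j t u) b = time t b + loopTime i j b (time u b)

infix 4 ⟨_,_⟩⇓_[≤_]
⟨_,_⟩⇓_[≤_] : ∀ {m} → Command m → Store m → Store m → ℕ → Set
⟨ c , σ ⟩⇓ σ′ [≤ T ] = ∃[ t ] (⟨ c , σ ⟩⇓ σ′ [ t ]) × t ≤ T

⇓⨾≤ : ∀ {m} {c d : Command m} {σ σ′ σ″ S T} →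
      ⟨ c , σ ⟩⇓ σ′ [≤ S ] → ⟨ d , σ′ ⟩⇓ σ″ [≤ T ] → ⟨ c ⨾ d , σ ⟩⇓ σ″ [≤ S + T ]
⇓⨾≤ (_ , r , s≤) (_ , q , t≤) = _ , ⇓⨾ r q , +-mono-≤ s≤ t≤

⇓:=≤ : ∀ {m} {σ : Store m} {x e} → ⟨ x := e , σ ⟩⇓ σ [ x ]≔ eval e σ [≤ suc (cost e) ]
⇓:=≤ = _ , ⇓:= , ≤-refl

⇓-weaken : ∀ {m} {c : Command m} {σ σ′ S T} → S ≤ T → ⟨ c , σ ⟩⇓ σ′ [≤ S ] → ⟨ c , σ ⟩⇓ σ′ [≤ T ]
⇓-weaken S≤T (_ , r , t≤) = _ , r , ≤-trans t≤ S≤T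

eval-tlⁿ : ∀ {m} i (e : Expr m) σ → eval (tlⁿ i e) σ ≡ tails i (eval e σ)
eval-tlⁿ zero    e σ = refl
eval-tlⁿ (suc i) e σ = eval-tlⁿ i (tl e) σ

eval-fromEnv : ∀ {m} (x : Fin m) (ρ : Store m) (e : Expr 4) σ →
               eval e σ ≡ envᵀ ρ → eval (fromEnv x e) σ ≡ lookup ρ x
eval-fromEnv zero    (a ∷ ρ) e σ eq = cong head eq
eval-fromEnv (suc x) (a ∷ ρ) e σ eq = eval-fromEnv x ρ (tl e) σ (cong tail eq)

eval-compileExpr : ∀ {m} (e : Expr m) (ρ : Store m) {r k C} →
                   eval (compileExpr e) (r ∷ envᵀ ρ ∷ k ∷ C ∷ []) ≡ eval e ρ
eval-compileExpr (var x)    ρ = eval-fromEnv x ρ (var env) _ refl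
eval-compileExpr nil        ρ = refl
eval-compileExpr (cons e f) ρ = cong₂ _∙_ (eval-compileExpr e ρ) (eval-compileExpr f ρ)
eval-compileExpr (hd e)     ρ = cong head (eval-compileExpr e ρ)
eval-compileExpr (tl e)     ρ = cong tail (eval-compileExpr e ρ)

spine≤size : ∀ t → spine t ≤ size t
spine≤size nil     = z≤n
spine≤size (s ∙ t) = s≤s (≤-trans (spine≤size t) (m≤n+m _ (size s)))

spine-tails : ∀ i t → spine (tails i t) ≤ spine t
spine-tails zero    t       = ≤-refl
spine-tails (suc i) nil     = spine-tails i nil
spine-tails (suc i) (s ∙ t) = ≤-trans (spine-tails i t) (n≤1+n _)

module _ {m} (ρ : Store m) (C : Tree) where

  private
    state : Tree → Tree → Store 4
    state r k = r ∷ envᵀ ρ ∷ k ∷ C ∷ []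

  while-correct : ∀ {c : Command 4} {f T} → (∀ r k → ⟨ c , state r k ⟩⇓ state (f r) k [≤ T ]) →
    ∀ l r k →
    ⟨ while hd (var stack) repeat (stack := cons (tl (hd (var stack))) (tl (var stack)) ⨾ c) ,
      state r (l ∙ k) ⟩⇓ state (iterate f r (spine l)) (nil ∙ k) [≤ spine l * (10 + T) + 3 ]
  while-correct body nil     r k = _ , ⇓done refl , ≤-refl
  while-correct {f = f} {T = T} body (x ∙ l) r k
    with _ , run , s≤ ← body r (l ∙ k)
       | _ , runs , t≤ ← while-correct body l (f r) k
    = _ , ⇓loop refl (⇓⨾ ⇓:= run) runs ,
      ≤-trans (+-mono-≤ (s≤s (s≤s (s≤s (+-monoʳ-≤ 7 s≤)))) t≤)
              (≤-reflexive (sym (+-assoc (10 + T) (spine l * (10 + T)) 3)))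

  loop-correct : ∀ {c : Command 4} {f T} →
    (∀ r k → ⟨ c , r ∷ (r ∙ envᵀ ρ) ∷ k ∷ C ∷ [] ⟩⇓ f r ∷ (r ∙ envᵀ ρ) ∷ k ∷ C ∷ [] [≤ T ]) →
    ∀ i j r k →
    ⟨ loop i j c , state r k ⟩⇓ state (iterate f r (spine (tails i C) ^ j)) k [≤ loopTime i j (size C) T ]
  loop-correct body i zero    r k = ⇓⨾≤ ⇓:=≤ (⇓⨾≤ (body r k) ⇓:=≤)
  loop-correct {c = c} {f = f} {T = T} body i (suc j) r k =
    ⇓⨾≤ ⇓:=≤ (⇓⨾≤ loops ⇓:=≤)
    where
    n : ℕ
    n = spine (tails i C) ^ j

    iterate-* : ∀ r l → iterate (λ r → iterate f r n) r l ≡ iterate f r (l * n)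
    iterate-* r zero    = refl
    iterate-* r (suc l) = trans (iterate-* (iterate f r n) l) (sym (iterate-+ f r n (l * n)))

    loops : ⟨ while hd (var stack) repeat (stack := cons (tl (hd (var stack))) (tl (var stack)) ⨾ loop i j c) ,
              state r (eval (ticks i) (state r k) ∙ k) ⟩⇓
            state (iterate f r (spine (tails i C) * n)) (nil ∙ k)
            [≤ size C * (10 + loopTime i j (size C) T) + 3 ]
    loops rewrite eval-tlⁿ i (var clock) (state r k) | sym (iterate-* r (spine (tails i C))) =
      ⇓-weaken (+-monoˡ-≤ 3 (*-monoˡ-≤ (10 + loopTime i j (size C) T)
                 (≤-trans (spine-tails i C) (spine≤size C))))
               (while-correct (loop-correct body i j) (tails i C) r k)

-- The cost of an operation does not depend on the trees it handles, and loops are governed by the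
-- clock alone. The bound is thus uniform in the values of the variables, which is what lets it pass
-- through nested loops.
compile-correct : ∀ {m} (t : Term m) C (ρ : Store m) r k →
  ⟨ compile t , r ∷ envᵀ ρ ∷ k ∷ C ∷ [] ⟩⇓ ⟦ t ⟧ C ρ ∷ envᵀ ρ ∷ k ∷ C ∷ [] [≤ time t (size C) ]
compile-correct (ret e) C ρ r k =
  subst (λ a → ⟨ result := compileExpr e , _ ⟩⇓ a ∷ _ [≤ _ ]) (eval-compileExpr e ρ) ⇓:=≤
compile-correct (cond e t u) C ρ r k
  with eval e ρ | eval-compileExpr e ρ {r} {k} {C}
... | nil   | eq = let _ , run , t≤ = compile-correct u C ρ r k in
  _ , ⇓else eq run , +-monoʳ-≤ (suc (cost (compileExpr e))) (≤-trans t≤ (m≤n+m _ _))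
... | _ ∙ _ | eq = let _ , run , t≤ = compile-correct t C ρ r k in
  _ , ⇓then eq run , +-monoʳ-≤ (suc (cost (compileExpr e))) (≤-trans t≤ (m≤m+n _ _))
compile-correct (rep i j t u) C ρ r k =
  ⇓⨾≤ (compile-correct t C ρ r k)
      (loop-correct ρ C (λ a k → compile-correct u C (a ∷ ρ) a k) i j _ k)

-- Polynomial bounds on the running time

PolynomiallyBounded : (ℕ → ℕ) → Set
PolynomiallyBounded f = ∃[ c ] ∃[ d ] ∀ b → 1 ≤ b → f b ≤ c * b ^ d

const-poly : ∀ c → PolynomiallyBounded (λ _ → c)
const-poly c = c , 0 , λ b _ → ≤-reflexive (sym (*-identityʳ c))

id-poly : PolynomiallyBounded (λ b → b)
id-poly = 1 , 1 , λ b _ → ≤-reflexive (sym (trans (*-identityˡ _) (*-identityʳ b)))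

*-poly : ∀ {f g} → PolynomiallyBounded f → PolynomiallyBounded g → PolynomiallyBounded (λ b → f b * g b)
*-poly (c , d , p) (c′ , d′ , q) = c * c′ , d + d′ , λ b 1≤b →
  ≤-trans (*-mono-≤ (p b 1≤b) (q b 1≤b))
          (≤-reflexive (trans ([m*n]*[o*p]≡[m*o]*[n*p] c (b ^ d) c′ (b ^ d′))
                              (cong (c * c′ *_) (sym (^-distribˡ-+-* b d d′)))))

-- Powers of a positive number grow with the exponent, so `d + d′` serves as a common exponent.
+-poly : ∀ {f g} → PolynomiallyBounded f → PolynomiallyBounded g → PolynomiallyBounded (λ b → f b + g b)
+-poly (c , d , p) (c′ , d′ , q) = c + c′ , d + d′ , λ { b@(suc _) 1≤b →
  ≤-trans (+-mono-≤ (≤-trans (p b 1≤b) (*-monoʳ-≤ c (^-monoʳ-≤ b (m≤m+n d d′))))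
                    (≤-trans (q b 1≤b) (*-monoʳ-≤ c′ (^-monoʳ-≤ b (m≤n+m d′ d)))))
          (≤-reflexive (sym (*-distribʳ-+ (b ^ (d + d′)) c c′))) }

loopTime-poly : ∀ i j {f} → PolynomiallyBounded f → PolynomiallyBounded (λ b → loopTime i j b (f b))
loopTime-poly i zero    p = +-poly (const-poly 4) (+-poly p (const-poly 3))
loopTime-poly i (suc j) p =
  +-poly (const-poly (suc (cost (cons (ticks i) (var stack)))))
    (+-poly (+-poly (*-poly id-poly (+-poly (const-poly 10) (loopTime-poly i j p))) (const-poly 3))
            (const-poly 3))

time-poly : ∀ {m} (t : Term m) → PolynomiallyBounded (time t)
time-poly (ret e)       = const-poly _
time-poly (cond e t u)  = +-poly (const-poly (suc (cost (compileExpr e)))) (+-poly (time-poly t) (time-poly u))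
time-poly (rep i j t u) = +-poly (time-poly t) (loopTime-poly i j (time-poly u))

-- The clock is the head of the input, which is the encoded graph: its spine consists of the vertex
-- set and the `n` rows. The whole input becomes the only variable of the term.
compileProgram : Term 1 → Program
compileProgram t = program {3} (clock := hd (var result) ⨾ env := cons (var result) nil ⨾ compile t)

program-correct : ∀ t C x →
  ∃[ s ] compileProgram t ⟦ C ∙ x ⟧⇓ ⟦ t ⟧ C ((C ∙ x) ∷ []) [ s ] × s ≤ 7 + time t (size C)
program-correct t C x =
  let _ , run , s≤ = compile-correct t C ((C ∙ x) ∷ []) (C ∙ x) nil in
  -- The 7 pays for the two initial assignments, 3 and 4.
  _ , (_ , ⇓⨾ ⇓:= (⇓⨾ ⇓:= run)) , +-monoʳ-≤ 7 s≤

size≥1 : ∀ t → 1 ≤ size t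
size≥1 nil     = s≤s z≤n
size≥1 (_ ∙ _) = s≤s z≤n

program-poly : ∀ t → ∃[ c ] ∃[ d ] ∀ C x →
  ∃[ s ] compileProgram t ⟦ C ∙ x ⟧⇓ ⟦ t ⟧ C ((C ∙ x) ∷ []) [ s ] × s ≤ c * size C ^ d
program-poly t = let c , d , p = +-poly (const-poly 7) (time-poly t) in
  c , d , λ C x → let s , run , s≤ = program-correct t C x in s , run , ≤-trans s≤ (p (size C) (size≥1 C))

-- The algorithm

-- The zeroth power of any length is 1, so `u` runs exactly once, with the value of `t` as variable
-- zero.
bind : ∀ {m} → Term m → Term (suc m) → Term m
bind t u = rep 0 0 t u

add : ∀ {m} → ℕ → Expr m → Term m
add j e = rep 0 j (ret e) (ret (cons nil (var 0F)))

-- On the pair of a and b, iterating n times subtracts a ⊓ n from both.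
drainStep : ∀ {m} → Term (suc m)
drainStep = cond (hd (var 0F)) (ret (cons (tl (hd (var 0F))) (tl (tl (var 0F))))) (ret (var 0F))

drain : ∀ {m} → ℕ → Expr m → Expr m → Term m
drain j e f = rep 0 j (ret (cons e f)) drainStep

-- The accumulator z consists of the rest of a row of the adjacency matrix, the
-- rest of the list of states, and a number d; where the row has an edge, t
-- computes the new d from z.
walk : ∀ {m} → Expr m → Expr m → Expr m → Term (suc m) → Term m
walk row states d t =
  bind (rep 1 1 (ret (cons row (cons states d)))
          (bind (cond (hd (hd (var 0F))) t (ret (tl (tl (var 0F)))))
                (ret (cons (tl (hd (var 1F))) (cons (tl (hd (tl (var 1F)))) (var 0F))))))
       (ret (tl (tl (var 0F))))

reverse : ∀ {m} → (∀ {m} → Expr m → Expr m) → Expr m → Term m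
reverse f e = bind (rep 1 1 (ret (cons e nil))
                      (ret (cons (tl (hd (var 0F))) (cons (f (hd (hd (var 0F)))) (tl (var 0F))))))
                   (ret (tl (var 0F)))

-- The exponents of the powers of N = n + 1 that serve as M, as slack in the test
-- for raising a potential, as bound on the potentials and as number of sweeps.
-- N is the length of the whole clock, and the clock without its first element
-- is the list of the n rows.
module Algorithm (scale slack height sweeps : ℕ) where

  monus : ∀ {m} → Expr m → Expr m → Term m
  monus e f = bind (drain height f e) (ret (tl (var 0F)))

  -- Variables: z (see walk), d, y v, the accumulator of sweep, the old states,
  -- the input; potential, selection, count and update see final parts of this
  -- list, or new values of v in place of z and d.
  pay : Term 6
  pay = bind (add scale (hd (hd (hd (tl (var 0F))))))
          (bind (monus (var 0F) (var 3F))
            -- Draining `M` times and then `M` times again stops at `M + M`: this is the upper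
            -- clipping of the share.
            (bind (rep 0 scale (drain scale (var 0F) (tl (tl (var 2F)))) drainStep)
                  (ret (tl (var 0F)))))

  potential : Term 4
  potential =
    -- Each of `M` walks along the row subtracts the load once from `N ^ slack + y v`. Something is
    -- left exactly if `v` must not be raised.
    bind (rep 0 scale (add slack (var 0F)) (walk (hd (hd (var 2F))) (var 3F) (var 0F) pay))
         (cond (var 0F) (ret (var 1F)) (add 1 (var 1F)))

  count : Term 6
  count = cond (tl (hd (hd (tl (var 0F)))))
            (bind (monus (hd (hd (hd (tl (var 0F))))) (var 2F))
                  (cond (var 0F) (ret (tl (tl (tl (var 1F))))) (ret (tl (tl (var 1F))))))
            (ret (tl (tl (var 0F))))

  selection : Term 5
  selection =
    -- The count runs down from `k`, so that something is left exactly if fewer than `k` selected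
    -- neighbours lie above `v`.
    bind (walk (hd (hd (var 2F))) (var 3F) (tl (var 4F)) count)
         (cond (hd (hd (tl (var 3F)))) (cond (var 0F) (ret (cons nil nil)) (ret nil)) (ret nil))

  update : Term 3
  update = bind (ret (hd (hd (hd (tl (tl (var 0F)))))))
             (bind potential (bind selection (ret (cons (var 1F) (var 0F)))))

  sweep : Term 2
  sweep =
    bind (rep 1 1 (ret (cons (tl (hd (var 1F))) (cons (hd (hd (var 1F))) (cons (var 0F) nil))))
            (bind update
              (ret (cons (tl (hd (var 1F))) (cons (tl (hd (tl (var 1F))))
                   (cons (tl (hd (tl (tl (var 1F))))) (cons (var 0F) (tl (tl (tl (var 1F)))))))))))
         (reverse id (tl (tl (tl (var 0F)))))

  -- The list is built from its end, and each new potential is one more than the previous one. The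
  -- head of `nil` is `nil`, so the first is 1 and the last is `n`.
  start : Term 1
  start = rep 1 1 (ret nil) (ret (cons (cons (cons nil (hd (hd (var 0F)))) nil) (var 0F)))

  algorithm : Term 1
  -- Two reversals preserve the order, and the second one drops the potentials, leaving the
  -- selections.
  algorithm = bind (rep 0 sweeps start sweep) (bind (reverse id (var 0F)) (reverse tl (var 0F)))

-- What the terms compute on encoded graphs

tabᵀ : ∀ {n} → (Fin n → Tree) → Tree
tabᵀ f = listᵀ (List.tabulate f)

tabᵀ-cong : ∀ {n} {f g : Fin n → Tree} → (∀ v → f v ≡ g v) → tabᵀ f ≡ tabᵀ g
tabᵀ-cong {zero}  f≗g = refl
tabᵀ-cong {suc n} f≗g = cong₂ _∙_ (f≗g zero) (tabᵀ-cong (f≗g ∘ suc))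

spine-tabᵀ : ∀ {n} (f : Fin n → Tree) → spine (tabᵀ f) ≡ n
spine-tabᵀ {zero}  f = refl
spine-tabᵀ {suc n} f = cong suc (spine-tabᵀ (f ∘ suc))

revOnto : ∀ {n} → (Fin n → Tree) → Tree → Tree
revOnto {zero}  f t = t
revOnto {suc n} f t = revOnto (f ∘ suc) (f zero ∙ t)

reverseStep : (Tree → Tree) → Tree → Tree
reverseStep φ a = tail (head a) ∙ (φ (head (head a)) ∙ tail a)

reverse-tabᵀ : ∀ {n} φ (f : Fin n → Tree) t →
               iterate (reverseStep φ) (tabᵀ f ∙ t) n ≡ nil ∙ revOnto (φ ∘ f) t
reverse-tabᵀ {zero}  φ f t = refl
reverse-tabᵀ {suc n} φ f t = reverse-tabᵀ φ (f ∘ suc) (φ (f zero) ∙ t)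

reverse-revOnto : ∀ {n} φ (f : Fin n → Tree) t u →
  iterate (reverseStep φ) (revOnto f t ∙ u) n ≡ t ∙ List.foldr _∙_ u (List.tabulate (φ ∘ f))
reverse-revOnto {zero}  φ f t u = refl
reverse-revOnto {suc n} φ f t u =
  trans (iterate-suc (reverseStep φ) (revOnto (f ∘ suc) (f zero ∙ t) ∙ u) n)
        (cong (reverseStep φ) (reverse-revOnto φ (f ∘ suc) (f zero ∙ t) u))

iterate-cong : ∀ {A : Set} {f g : A → A} → (∀ a → f a ≡ g a) → ∀ a n → iterate f a n ≡ iterate g a n
iterate-cong f≗g a zero    = refl
iterate-cong {f = f} f≗g a (suc n) = trans (cong (λ b → iterate f b n) (f≗g a)) (iterate-cong f≗g _ n)

add-correct : ∀ a n → iterate (nil ∙_) (natᵀ a) n ≡ natᵀ (n + a)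
add-correct a zero    = refl
add-correct a (suc n) = trans (add-correct (suc a) n) (cong natᵀ (+-suc n a))

drainᵀ : Tree → Tree
drainᵀ a = ifᵀ (head a) (tail (head a) ∙ tail (tail a)) a

tail-natᵀ : ∀ a → tail (natᵀ a) ≡ natᵀ (pred a)
tail-natᵀ zero    = refl
tail-natᵀ (suc a) = refl

drain-correct : ∀ a b n → iterate drainᵀ (natᵀ a ∙ natᵀ b) n ≡ natᵀ (a ∸ n) ∙ natᵀ (b ∸ a ⊓ n)
drain-correct a       b zero    = cong (λ c → natᵀ a ∙ natᵀ (b ∸ c)) (sym (⊓-zeroʳ a))
drain-correct zero    b (suc n) =
  trans (drain-correct zero b n) (cong (λ c → natᵀ c ∙ natᵀ b) (0∸n≡0 n))
drain-correct (suc a) b (suc n) =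
  trans (cong (λ t → iterate drainᵀ (natᵀ a ∙ t) n) (tail-natᵀ b))
 (trans (drain-correct a (pred b) n) (cong (λ c → natᵀ (a ∸ n) ∙ natᵀ c) (pred-∸ b (a ⊓ n))))
  where
  pred-∸ : ∀ b c → pred b ∸ c ≡ b ∸ suc c
  pred-∸ zero    c = 0∸n≡0 c
  pred-∸ (suc b) c = refl

-- This is how the terms compare numbers: by testing a truncated difference.
ifᵀ-∸ : ∀ {A : Set} a b (x y : A) → ifᵀ (natᵀ (a ∸ b)) x y ≡ (Bool.if b <ᵇ a then x else y)
ifᵀ-∸ zero    zero    x y = refl
ifᵀ-∸ zero    (suc b) x y = refl
ifᵀ-∸ (suc a) zero    x y = refl
ifᵀ-∸ (suc a) (suc b) x y = ifᵀ-∸ a b x y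

iterate-∸ : ∀ (f : Tree → Tree) c → (∀ a → f (natᵀ a) ≡ natᵀ (a ∸ c)) →
            ∀ a n → iterate f (natᵀ a) n ≡ natᵀ (a ∸ n * c)
iterate-∸ f c f-∸ a zero    = refl
iterate-∸ f c f-∸ a (suc n) =
  trans (cong (λ t → iterate f t n) (f-∸ a))
 (trans (iterate-∸ f c f-∸ (a ∸ c) n) (cong natᵀ (∸-+-assoc a c (n * c))))

walkStep : (Tree → Tree) → Tree → Tree
walkStep f z = tail (head z) ∙ tail (head (tail z)) ∙ ifᵀ (head (head z)) (f z) (tail (tail z))

walk-correct : ∀ {n} (f : Tree → Tree) (row : Fin n → Bool) (s : Fin n → Tree) (h : Fin n → ℕ) →
  (∀ u r r′ s′ d → f ((r ∙ r′) ∙ (s u ∙ s′) ∙ natᵀ d) ≡ natᵀ (d ∸ h u)) →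
  ∀ d → iterate (walkStep f) (tabᵀ (boolᵀ ∘ row) ∙ tabᵀ s ∙ natᵀ d) n
        ≡ nil ∙ nil ∙ natᵀ (d ∸ sum (λ u → bit (row u) * h u))
walk-correct {zero}  f row s h f-∸ d = refl
walk-correct {suc n} f row s h f-∸ d = step (row zero) refl
  where
  rest : ∀ d → _
  rest = walk-correct f (row ∘ suc) (s ∘ suc) (h ∘ suc) (f-∸ ∘ suc)

  step : ∀ b → row zero ≡ b →
         iterate (walkStep f) (tabᵀ (boolᵀ ∘ row) ∙ tabᵀ s ∙ natᵀ d) (suc n)
         ≡ nil ∙ nil ∙ natᵀ (d ∸ sum (λ u → bit (row u) * h u))
  step true  eq rewrite eq =
    trans (cong (λ t → iterate (walkStep f) (tabᵀ (boolᵀ ∘ row ∘ suc) ∙ tabᵀ (s ∘ suc) ∙ t) n)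
                (f-∸ zero (nil ∙ nil) _ _ d))
   (trans (rest (d ∸ h zero))
          (cong (λ c → nil ∙ nil ∙ natᵀ c)
            (trans (∸-+-assoc d (h zero) _)
                   (cong (λ c → d ∸ (c + sum (λ u → bit (row (suc u)) * h (suc u)))) (sym (+-identityʳ (h zero)))))))
  step false eq rewrite eq = rest d

mapStep : (Tree → Tree) → Tree → Tree
mapStep f w = tail (head w) ∙ tail (head (tail w)) ∙ tail (head (tail (tail w))) ∙ f w ∙ tail (tail (tail w))

map-correct : ∀ {n} (f : Tree → Tree) (p q r g : Fin n → Tree) →
  (∀ v p′ q′ r′ o → f ((p v ∙ p′) ∙ (q v ∙ q′) ∙ (r v ∙ r′) ∙ o) ≡ g v) →
  ∀ o → iterate (mapStep f) (tabᵀ p ∙ tabᵀ q ∙ tabᵀ r ∙ o) n ≡ nil ∙ nil ∙ nil ∙ revOnto g o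
map-correct {zero}  f p q r g f≡g o = refl
map-correct {suc n} f p q r g f≡g o =
  trans (cong (λ t → iterate (mapStep f) (tabᵀ (p ∘ suc) ∙ tabᵀ (q ∘ suc) ∙ tabᵀ (r ∘ suc) ∙ t ∙ o) n)
              (f≡g zero _ _ _ o))
        (map-correct f (p ∘ suc) (q ∘ suc) (r ∘ suc) (g ∘ suc) (f≡g ∘ suc) (g zero ∙ o))

start-correct : ∀ n → iterate (λ a → ((nil ∙ head (head a)) ∙ nil) ∙ a) nil n
                      ≡ tabᵀ {n} (λ v → natᵀ (n ∸ toℕ v) ∙ boolᵀ false)
start-correct zero          = refl
start-correct (suc zero)    = refl
start-correct (suc (suc n)) =
  trans (iterate-suc _ nil (suc n)) (cong (λ a → ((nil ∙ head (head a)) ∙ nil) ∙ a) (start-correct (suc n)))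

module Semantics (scale slack height sweeps : ℕ)
                 {n} (a : Fin n → Fin n → Bool) (member : Fin n → Bool) (k : ℕ) where
  open Algorithm scale slack height sweeps

  N M : ℕ
  N = suc n
  M = N ^ scale

  -- The starting values n ∸ toℕ v are distinct modulo N.  As potentials are
  -- raised by N, they remain distinct and therefore order the vertices.
  raise : (Fin n → ℕ) → Fin n → ℕ
  raise y v = Bool.if M * load M a y v <ᵇ N ^ slack + y v then y v else N ^ 1 + y v

  select : (Fin n → ℕ) → (Fin n → Bool) → Fin n → Bool
  select y S v = member v ∧ (aboveDegree a y S v <ᵇ k)

  potentials : ℕ → Fin n → ℕ
  potentials zero    v = n ∸ toℕ v
  potentials (suc t) v = raise (potentials t) v

  -- A sweep recomputes all selections at once from those before it, with the potentials of the
  -- moment. Early values carry no meaning; the final ones are a fixed point.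
  selections : ℕ → Fin n → Bool
  selections zero    v = false
  selections (suc t) v = select (potentials t) (selections t) v

  graph : Tree
  graph = tabᵀ (boolᵀ ∘ member) ∙ tabᵀ (λ v → tabᵀ (boolᵀ ∘ a v))

  stateᵀ : (Fin n → ℕ) → (Fin n → Bool) → Tree
  stateᵀ y S = tabᵀ (λ v → natᵀ (y v) ∙ boolᵀ (S v))

  clock-ticks : ∀ j → spine graph ^ j ≡ N ^ j
  clock-ticks j = cong (λ l → suc l ^ j) (spine-tabᵀ (λ v → tabᵀ (boolᵀ ∘ a v)))

  row-ticks : spine (tail graph) ^ 1 ≡ n
  row-ticks = trans (*-identityʳ _) (spine-tabᵀ (λ v → tabᵀ (boolᵀ ∘ a v)))

  ⟦add⟧ : ∀ {m} j (e : Expr m) ρ {b} → eval e ρ ≡ natᵀ b → ⟦ add j e ⟧ graph ρ ≡ natᵀ (N ^ j + b)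
  ⟦add⟧ j e ρ {b} eq = trans (cong₂ (iterate (nil ∙_)) eq (clock-ticks j)) (add-correct b (N ^ j))

  -- The drain subtracts no more than its number of rounds, so the subtrahend has to be used up
  -- within `N ^ height` of them. This is where the bound on potentials enters.
  ⟦monus⟧ : ∀ {m} (e f : Expr m) ρ {b c} → eval e ρ ≡ natᵀ b → eval f ρ ≡ natᵀ c → c ≤ N ^ height →
            ⟦ monus e f ⟧ graph ρ ≡ natᵀ (b ∸ c)
  ⟦monus⟧ e f ρ {b} {c} eqb eqc c≤ = begin
    tail (iterate drainᵀ (eval f ρ ∙ eval e ρ) (spine graph ^ height))
      ≡⟨ cong tail (cong₂ (iterate drainᵀ) (cong₂ _∙_ eqc eqb) (clock-ticks height)) ⟩
    tail (iterate drainᵀ (natᵀ c ∙ natᵀ b) (N ^ height))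
      ≡⟨ cong tail (drain-correct c b (N ^ height)) ⟩
    natᵀ (b ∸ c ⊓ N ^ height)
      ≡⟨ cong (λ c → natᵀ (b ∸ c)) (m≤n⇒m⊓n≡m c≤) ⟩
    natᵀ (b ∸ c) ∎
    where open ≡-Reasoning

  ⟦walk⟧ : ∀ {m} (row st d : Expr m) (t : Term (suc m)) ρ (r : Fin n → Bool) (s : Fin n → Tree) (h : Fin n → ℕ) {b} →
    eval row ρ ≡ tabᵀ (boolᵀ ∘ r) → eval st ρ ≡ tabᵀ s → eval d ρ ≡ natᵀ b →
    (∀ u x x′ s′ d → ⟦ t ⟧ graph (((x ∙ x′) ∙ (s u ∙ s′) ∙ natᵀ d) ∷ ρ) ≡ natᵀ (d ∸ h u)) →
    ⟦ walk row st d t ⟧ graph ρ ≡ natᵀ (b ∸ sum (λ u → bit (r u) * h u))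
  ⟦walk⟧ row st d t ρ r s h {b} eqr eqs eqd t-correct = cong (tail ∘ tail) (begin
    iterate step (eval row ρ ∙ eval st ρ ∙ eval d ρ) (spine (tail graph) ^ 1)
      ≡⟨ cong₂ (iterate step) (cong₂ _∙_ eqr (cong₂ _∙_ eqs eqd)) row-ticks ⟩
    iterate step (tabᵀ (boolᵀ ∘ r) ∙ tabᵀ s ∙ natᵀ b) n
      ≡⟨ walk-correct (λ z → ⟦ t ⟧ graph (z ∷ ρ)) r s h t-correct b ⟩
    nil ∙ nil ∙ natᵀ (b ∸ sum (λ u → bit (r u) * h u)) ∎)
    where
    open ≡-Reasoning
    step : Tree → Tree
    step = walkStep (λ z → ⟦ t ⟧ graph (z ∷ ρ))

  ⟦reverse⟧ : ∀ {m} (φ : ∀ {m} → Expr m → Expr m) (e : Expr m) ρ →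
    ∀ φᵀ → (∀ {l} (e : Expr l) σ → eval (φ e) σ ≡ φᵀ (eval e σ)) →
    ⟦ reverse φ e ⟧ graph ρ ≡ tail (iterate (reverseStep φᵀ) (eval e ρ ∙ nil) n)
  ⟦reverse⟧ φ e ρ φᵀ eq = cong tail (trans
    (iterate-cong (λ x → cong (λ y → tail (head x) ∙ (y ∙ tail x)) (eq (hd (hd (var 0F))) (x ∷ ρ)))
                  (eval e ρ ∙ nil) (spine (tail graph) ^ 1))
    (cong (iterate (reverseStep φᵀ) (eval e ρ ∙ nil)) row-ticks))

  module _ {y : Fin n → ℕ} (S : Fin n → Bool) (y≤ : ∀ v → y v ≤ N ^ height) where

    private
      s : Fin n → Tree
      s v = natᵀ (y v) ∙ boolᵀ (S v)

    ⟦pay⟧ : ∀ v u x x′ s′ d d₀ w st z →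
      ⟦ pay ⟧ graph (((x ∙ x′) ∙ (s u ∙ s′) ∙ natᵀ d) ∷ d₀ ∷ natᵀ (y v) ∷ w ∷ st ∷ z ∷ [])
      ≡ natᵀ (d ∸ share M y v u)
    ⟦pay⟧ v u x x′ s′ d d₀ w st z = begin
      ⟦ pay ⟧ graph ρ
        ≡⟨ cong (λ p → ⟦ bind (monus (var 0F) (var 3F)) rest ⟧ graph (p ∷ ρ))
                (⟦add⟧ scale (hd (hd (hd (tl (var 0F))))) ρ {y u} refl) ⟩
      ⟦ bind (monus (var 0F) (var 3F)) rest ⟧ graph (natᵀ (M + y u) ∷ ρ)
        ≡⟨ cong (λ q → ⟦ rest ⟧ graph (q ∷ natᵀ (M + y u) ∷ ρ))
                (⟦monus⟧ (var 0F) (var 3F) (natᵀ (M + y u) ∷ ρ) {M + y u} {y v} refl refl (y≤ v)) ⟩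
      tail (iterate drainᵀ (iterate drainᵀ (natᵀ p ∙ natᵀ d) (spine graph ^ scale)) (spine graph ^ scale))
        ≡⟨ cong tail (sym (iterate-+ drainᵀ (natᵀ p ∙ natᵀ d) (spine graph ^ scale) (spine graph ^ scale))) ⟩
      tail (iterate drainᵀ (natᵀ p ∙ natᵀ d) (spine graph ^ scale + spine graph ^ scale))
        ≡⟨ cong (λ m → tail (iterate drainᵀ (natᵀ p ∙ natᵀ d) (m + m))) (clock-ticks scale) ⟩
      tail (iterate drainᵀ (natᵀ p ∙ natᵀ d) (M + M))
        ≡⟨ cong tail (drain-correct p d (M + M)) ⟩
      natᵀ (d ∸ share M y v u) ∎
      where
      open ≡-Reasoning
      ρ : Store 6
      ρ = ((x ∙ x′) ∙ (s u ∙ s′) ∙ natᵀ d) ∷ d₀ ∷ natᵀ (y v) ∷ w ∷ st ∷ z ∷ []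
      p : ℕ
      p = M + y u ∸ y v
      rest : Term 8
      rest = bind (rep 0 scale (drain scale (var 0F) (tl (tl (var 2F)))) drainStep) (ret (tl (var 0F)))

    natᵀ-if : ∀ b {c d} → (Bool.if b then natᵀ c else natᵀ d) ≡ natᵀ (Bool.if b then c else d)
    natᵀ-if true  = refl
    natᵀ-if false = refl

    ⟦potential⟧ : ∀ v r w z →
      ⟦ potential ⟧ graph (natᵀ (y v) ∷ ((tabᵀ (boolᵀ ∘ a v) ∙ r) ∙ w) ∷ stateᵀ y S ∷ z ∷ [])
      ≡ natᵀ (raise y v)
    ⟦potential⟧ v r w z = begin
      ⟦ potential ⟧ graph ρ
        ≡⟨ cong (λ d → ifᵀ d (natᵀ (y v)) (⟦ add 1 (var 1F) ⟧ graph (d ∷ ρ))) deficit ⟩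
      ifᵀ (natᵀ d) (natᵀ (y v)) (⟦ add 1 (var 1F) ⟧ graph (natᵀ d ∷ ρ))
        ≡⟨ cong (ifᵀ (natᵀ d) (natᵀ (y v))) (⟦add⟧ 1 (var 1F) (natᵀ d ∷ ρ) {y v} refl) ⟩
      ifᵀ (natᵀ d) (natᵀ (y v)) (natᵀ (N ^ 1 + y v))
        ≡⟨ ifᵀ-∸ (N ^ slack + y v) (M * load M a y v) (natᵀ (y v)) (natᵀ (N ^ 1 + y v)) ⟩
      (Bool.if M * load M a y v <ᵇ N ^ slack + y v then natᵀ (y v) else natᵀ (N ^ 1 + y v))
        ≡⟨ natᵀ-if (M * load M a y v <ᵇ N ^ slack + y v) ⟩
      natᵀ (raise y v) ∎
      where
      open ≡-Reasoning
      ρ : Store 4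
      ρ = natᵀ (y v) ∷ ((tabᵀ (boolᵀ ∘ a v) ∙ r) ∙ w) ∷ stateᵀ y S ∷ z ∷ []

      d : ℕ
      d = N ^ slack + y v ∸ M * load M a y v

      walk-pay : Tree → Tree
      walk-pay d = ⟦ walk (hd (hd (var 2F))) (var 3F) (var 0F) pay ⟧ graph (d ∷ ρ)

      deficit : ⟦ rep 0 scale (add slack (var 0F)) (walk (hd (hd (var 2F))) (var 3F) (var 0F) pay) ⟧ graph ρ
                ≡ natᵀ d
      deficit = trans
        (cong₂ (iterate walk-pay) (⟦add⟧ slack (var 0F) ρ {y v} refl) (clock-ticks scale))
        (iterate-∸ walk-pay (load M a y v)
          (λ d → ⟦walk⟧ (hd (hd (var 2F))) (var 3F) (var 0F) pay (natᵀ d ∷ ρ)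
                   (a v) s (share M y v) {d} refl refl refl
                   (λ u x x′ s′ d′ → ⟦pay⟧ v u x x′ s′ d′ (natᵀ d)
                                      ((tabᵀ (boolᵀ ∘ a v) ∙ r) ∙ w) (stateᵀ y S) z))
          (N ^ slack + y v) M)

    ⟦count⟧ : ∀ v u x x′ s′ d y′ w st z →
      ⟦ count ⟧ graph (((x ∙ x′) ∙ (s u ∙ s′) ∙ natᵀ d) ∷ y′ ∷ natᵀ (y v) ∷ w ∷ st ∷ z ∷ [])
      ≡ natᵀ (d ∸ above y S v u)
    ⟦count⟧ v u x x′ s′ d y′ w st z with S u
    ... | false = refl
    ... | true  = begin
      ifᵀ (⟦ monus (hd (hd (hd (tl (var 0F))))) (var 2F) ⟧ graph ρ) (tail (natᵀ d)) (natᵀ d)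
        ≡⟨ cong (λ q → ifᵀ q (tail (natᵀ d)) (natᵀ d))
             (⟦monus⟧ (hd (hd (hd (tl (var 0F))))) (var 2F) ρ {y u} {y v} refl refl (y≤ v)) ⟩
      ifᵀ (natᵀ (y u ∸ y v)) (tail (natᵀ d)) (natᵀ d)
        ≡⟨ ifᵀ-∸ (y u) (y v) (tail (natᵀ d)) (natᵀ d) ⟩
      (Bool.if y v <ᵇ y u then tail (natᵀ d) else natᵀ d)
        ≡⟨ decrease (y v <ᵇ y u) ⟩
      natᵀ (d ∸ bit (y v <ᵇ y u)) ∎
      where
      open ≡-Reasoning
      ρ : Store 6
      ρ = ((x ∙ x′) ∙ ((natᵀ (y u) ∙ boolᵀ true) ∙ s′) ∙ natᵀ d) ∷ y′ ∷ natᵀ (y v) ∷ w ∷ st ∷ z ∷ []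
      decrease : ∀ b → (Bool.if b then tail (natᵀ d) else natᵀ d) ≡ natᵀ (d ∸ bit b)
      decrease true  = trans (tail-natᵀ d) (cong natᵀ (pred[n]≡n∸1 d))
        where
        pred[n]≡n∸1 : ∀ d → pred d ≡ d ∸ 1
        pred[n]≡n∸1 zero    = refl
        pred[n]≡n∸1 (suc d) = refl
      decrease false = refl

    ⟦selection⟧ : ∀ v r q w y′ z →
      ⟦ selection ⟧ graph
        (y′ ∷ natᵀ (y v) ∷ ((tabᵀ (boolᵀ ∘ a v) ∙ r) ∙ (boolᵀ (member v) ∙ q) ∙ w) ∷ stateᵀ y S ∷ (z ∙ natᵀ k) ∷ [])
      ≡ boolᵀ (select y S v)
    ⟦selection⟧ v r q w y′ z = begin
      ⟦ selection ⟧ graph ρ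
        ≡⟨ cong (λ c → ifᵀ (boolᵀ (member v)) (ifᵀ c (boolᵀ true) nil) nil)
             (⟦walk⟧ (hd (hd (var 2F))) (var 3F) (tl (var 4F)) count ρ (a v) s (above y S v) {k} refl refl refl
               (λ u x x′ s′ d → ⟦count⟧ v u x x′ s′ d y′ w′ (stateᵀ y S) (z ∙ natᵀ k))) ⟩
      ifᵀ (boolᵀ (member v)) (ifᵀ (natᵀ (k ∸ aboveDegree a y S v)) (boolᵀ true) nil) nil
        ≡⟨ cong (λ c → ifᵀ (boolᵀ (member v)) c nil) (ifᵀ-∸ k (aboveDegree a y S v) (boolᵀ true) nil) ⟩
      ifᵀ (boolᵀ (member v)) (Bool.if aboveDegree a y S v <ᵇ k then boolᵀ true else nil) nil
        ≡⟨ conjunction (member v) (aboveDegree a y S v <ᵇ k) ⟩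
      boolᵀ (select y S v) ∎
      where
      open ≡-Reasoning
      w′ : Tree
      w′ = (tabᵀ (boolᵀ ∘ a v) ∙ r) ∙ (boolᵀ (member v) ∙ q) ∙ w
      ρ : Store 5
      ρ = y′ ∷ natᵀ (y v) ∷ w′ ∷ stateᵀ y S ∷ (z ∙ natᵀ k) ∷ []
      conjunction : ∀ b c → ifᵀ (boolᵀ b) (Bool.if c then boolᵀ true else nil) nil ≡ boolᵀ (b ∧ c)
      conjunction true  true  = refl
      conjunction true  false = refl
      conjunction false _     = refl

    ⟦update⟧ : ∀ x v p q r o →
      ⟦ update ⟧ graph
        (((tabᵀ (boolᵀ ∘ a v) ∙ p) ∙ (boolᵀ (member v) ∙ q) ∙ (s v ∙ r) ∙ o) ∷ stateᵀ y S ∷ (x ∙ natᵀ k) ∷ [])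
      ≡ natᵀ (raise y v) ∙ boolᵀ (select y S v)
    ⟦update⟧ x v p q r o =
      cong₂ _∙_ (⟦potential⟧ v p ((boolᵀ (member v) ∙ q) ∙ (s v ∙ r) ∙ o) (x ∙ natᵀ k))
                (⟦selection⟧ v p q ((s v ∙ r) ∙ o) (⟦ potential ⟧ graph ρ) x)
      where
      ρ : Store 4
      ρ = natᵀ (y v) ∷ ((tabᵀ (boolᵀ ∘ a v) ∙ p) ∙ (boolᵀ (member v) ∙ q) ∙ (s v ∙ r) ∙ o) ∷
          stateᵀ y S ∷ (x ∙ natᵀ k) ∷ []

    ⟦sweep⟧ : ⟦ sweep ⟧ graph (stateᵀ y S ∷ (graph ∙ natᵀ k) ∷ []) ≡ stateᵀ (raise y) (select y S)
    ⟦sweep⟧ = begin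
      ⟦ sweep ⟧ graph ρ
        ≡⟨ ⟦reverse⟧ id (tl (tl (tl (var 0F)))) (iterate (mapStep f) start′ (spine (tail graph) ^ 1) ∷ ρ)
                     id (λ _ _ → refl) ⟩
      tail (iterate (reverseStep id) (tail (tail (tail (iterate (mapStep f) start′ (spine (tail graph) ^ 1)))) ∙ nil) n)
        ≡⟨ cong (λ w → tail (iterate (reverseStep id) (tail (tail (tail w)) ∙ nil) n))
             (trans (cong (iterate (mapStep f) start′) row-ticks)
                    (map-correct f (λ v → tabᵀ (boolᵀ ∘ a v)) (boolᵀ ∘ member) s s′
                      (λ v p q r o → ⟦update⟧ graph v p q r o) nil)) ⟩
      tail (iterate (reverseStep id) (revOnto s′ nil ∙ nil) n)
        ≡⟨ cong tail (reverse-revOnto id s′ nil nil) ⟩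
      stateᵀ (raise y) (select y S) ∎
      where
      open ≡-Reasoning
      ρ : Store 2
      ρ = stateᵀ y S ∷ (graph ∙ natᵀ k) ∷ []
      f : Tree → Tree
      f w = ⟦ update ⟧ graph (w ∷ ρ)
      s′ : Fin n → Tree
      s′ v = natᵀ (raise y v) ∙ boolᵀ (select y S v)
      start′ : Tree
      start′ = tail graph ∙ head graph ∙ stateᵀ y S ∙ nil

  ⟦algorithm⟧ : (∀ t v → potentials t v ≤ N ^ height) →
    ⟦ algorithm ⟧ graph ((graph ∙ natᵀ k) ∷ []) ≡ tabᵀ (boolᵀ ∘ selections (N ^ sweeps))
  ⟦algorithm⟧ bounded = begin
    ⟦ algorithm ⟧ graph ρ
      ≡⟨ ⟦reverse⟧ tl (var 0F) (⟦ reverse id (var 0F) ⟧ graph (state ∷ ρ) ∷ state ∷ ρ) tail (λ _ _ → refl) ⟩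
    tail (iterate (reverseStep tail) (⟦ reverse id (var 0F) ⟧ graph (state ∷ ρ) ∙ nil) n)
      ≡⟨ cong (λ w → tail (iterate (reverseStep tail) (w ∙ nil) n)) (⟦reverse⟧ id (var 0F) (state ∷ ρ) id (λ _ _ → refl)) ⟩
    tail (iterate (reverseStep tail) (tail (iterate (reverseStep id) (state ∙ nil) n) ∙ nil) n)
      ≡⟨ cong (λ w → tail (iterate (reverseStep tail) (tail (iterate (reverseStep id) (w ∙ nil) n) ∙ nil) n))
           (trans (cong₂ (iterate step) initial (clock-ticks sweeps)) (states (N ^ sweeps))) ⟩
    tail (iterate (reverseStep tail) (tail (iterate (reverseStep id) (tabᵀ s ∙ nil) n) ∙ nil) n)
      ≡⟨ cong (λ w → tail (iterate (reverseStep tail) (tail w ∙ nil) n)) (reverse-tabᵀ id s nil) ⟩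
    tail (iterate (reverseStep tail) (revOnto s nil ∙ nil) n)
      ≡⟨ cong tail (reverse-revOnto tail s nil nil) ⟩
    tabᵀ (boolᵀ ∘ selections (N ^ sweeps)) ∎
    where
    open ≡-Reasoning
    ρ : Store 1
    ρ = (graph ∙ natᵀ k) ∷ []
    state : Tree
    state = ⟦ rep 0 sweeps start sweep ⟧ graph ρ
    s : Fin n → Tree
    s v = natᵀ (potentials (N ^ sweeps) v) ∙ boolᵀ (selections (N ^ sweeps) v)
    step : Tree → Tree
    step w = ⟦ sweep ⟧ graph (w ∷ ρ)

    initial : ⟦ start ⟧ graph ρ ≡ stateᵀ (potentials 0) (selections 0)
    initial = trans (cong (iterate _ nil) row-ticks) (start-correct n)

    states : ∀ t → iterate step (stateᵀ (potentials 0) (selections 0)) t ≡ stateᵀ (potentials t) (selections t)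
    states zero    = refl
    states (suc t) = trans (iterate-suc step _ t)
      (trans (cong step (states t)) (⟦sweep⟧ (selections t) (bounded t)))

-- Convergence of the sweeps

share-mono : ∀ {n} M (y y′ : Fin n → ℕ) v → y′ v ≡ y v → (∀ u → y u ≤ y′ u) →
             ∀ u → share M y v u ≤ share M y′ v u
share-mono M y y′ v eq y≤ u rewrite eq = ⊓-mono-≤ (∸-monoˡ-≤ (y v) (+-monoʳ-≤ M (y≤ u))) ≤-refl

-- Raising `v` by `c` costs it at most `c` on each edge, as clipping never enlarges differences and
-- raising the neighbours only helps `v`.
share-drop : ∀ {n} M c (y y′ : Fin n → ℕ) v → y′ v ≡ c + y v → (∀ u → y u ≤ y′ u) →
             ∀ u → share M y v u ≤ share M y′ v u + c
share-drop M c y y′ v eq y≤ u rewrite eq = begin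
  (M + y u ∸ y v) ⊓ (M + M)
    ≤⟨ ⊓-mono-≤ first (m≤m+n (M + M) c) ⟩
  (M + y′ u ∸ (c + y v) + c) ⊓ (M + M + c)
    ≡⟨ sym (+-distribʳ-⊓ c (M + y′ u ∸ (c + y v)) (M + M)) ⟩
  (M + y′ u ∸ (c + y v)) ⊓ (M + M) + c ∎
  where
  open ≤-Reasoning
  first : M + y u ∸ y v ≤ M + y′ u ∸ (c + y v) + c
  first = begin
    M + y u ∸ y v
      ≤⟨ ∸-monoˡ-≤ (y v) (+-monoʳ-≤ M (y≤ u)) ⟩
    M + y′ u ∸ y v
      ≤⟨ m≤n+m∸n (M + y′ u ∸ y v) c ⟩
    c + (M + y′ u ∸ y v ∸ c)
      ≡⟨ cong (c +_) (trans (∸-+-assoc (M + y′ u) (y v) c) (cong (M + y′ u ∸_) (+-comm (y v) c))) ⟩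
    c + (M + y′ u ∸ (c + y v))
      ≡⟨ +-comm c _ ⟩
    M + y′ u ∸ (c + y v) + c ∎

module _ {n} (M : ℕ) (a : Fin n → Fin n → Bool) where

  load-mono : ∀ (y y′ : Fin n → ℕ) v → y′ v ≡ y v → (∀ u → y u ≤ y′ u) → load M a y v ≤ load M a y′ v
  load-mono y y′ v eq y≤ = sum-mono-≤ (λ u → *-monoʳ-≤ (bit (a v u)) (share-mono M y y′ v eq y≤ u))

  load-drop : ∀ c (y y′ : Fin n → ℕ) v → y′ v ≡ c + y v → (∀ u → y u ≤ y′ u) →
              load M a y v ≤ load M a y′ v + n * c
  load-drop c y y′ v eq y≤ = begin
    load M a y v
      ≤⟨ sum-mono-≤ (λ u → *-monoʳ-≤ (bit (a v u)) (share-drop M c y y′ v eq y≤ u)) ⟩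
    sum (λ u → bit (a v u) * (share M y′ v u + c))
      ≡⟨ sum-cong-≗ (λ u → *-distribˡ-+ (bit (a v u)) (share M y′ v u) c) ⟩
    sum (λ u → bit (a v u) * share M y′ v u + bit (a v u) * c)
      ≡⟨ ∑-distrib-+ (λ u → bit (a v u) * share M y′ v u) (λ u → bit (a v u) * c) ⟩
    load M a y′ v + sum (λ u → bit (a v u) * c)
      ≤⟨ +-monoʳ-≤ (load M a y′ v)
           (sum≤n*c (λ u → ≤-trans (*-monoˡ-≤ c (bit≤1 (a v u))) (≤-reflexive (*-identityˡ c)))) ⟩
    load M a y′ v + n * c ∎
    where open ≤-Reasoning

  load-≤ : ∀ y v → load M a y v ≤ n * (M + M)
  load-≤ y v = sum≤n*c (λ u →
    ≤-trans (*-mono-≤ (bit≤1 (a v u)) (m⊓n≤n (M + y u ∸ y v) (M + M))) (≤-reflexive (*-identityˡ (M + M))))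

  load-cong : ∀ {y y′ : Fin n → ℕ} → (∀ u → y u ≡ y′ u) → ∀ v → load M a y v ≡ load M a y′ v
  load-cong y≗y′ v = sum-cong-≗ (λ u →
    cong (bit (a v u) *_) (cong₂ (λ p q → (M + q ∸ p) ⊓ (M + M)) (y≗y′ v) (y≗y′ u)))

-- `N ^ slack` is `M * N ^ 2`, which covers the fall of `M * load` when a vertex is raised by `N`.
-- `N ^ height` is `M * N ^ slack` and bounds `M * load`, a load being at most `n * (M + M)`. The
-- potentials come to rest within `N ^ suc height` sweeps, and a further factor `N` leaves time for
-- the selections.
slack height sweeps : ℕ → ℕ
slack scale  = scale + 2
height scale = scale + slack scale
sweeps scale = 2 + height scale

module Convergence (scale : ℕ) {n} (a : Fin n → Fin n → Bool) (member : Fin n → Bool) (k : ℕ) where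
  open Semantics scale (slack scale) (height scale) (sweeps scale) a member k public

  raise-cases : ∀ y v → (M * load M a y v < N ^ slack scale + y v × raise y v ≡ y v) ⊎
                        (N ^ slack scale + y v ≤ M * load M a y v × raise y v ≡ N ^ 1 + y v)
  raise-cases y v with M * load M a y v <? N ^ slack scale + y v
  ... | yes lt = inj₁ (lt , cong (λ b → Bool.if b then y v else N ^ 1 + y v) (dec-true (_ <? _) lt))
  ... | no ≮   = inj₂ (≮⇒≥ ≮ , cong (λ b → Bool.if b then y v else N ^ 1 + y v) (dec-false (_ <? _) ≮))

  raise-≥ : ∀ y v → y v ≤ raise y v
  raise-≥ y v with raise-cases y v
  ... | inj₁ (_ , eq) = ≤-reflexive (sym eq)
  ... | inj₂ (_ , eq) = ≤-trans (m≤n+m (y v) (N ^ 1)) (≤-reflexive (sym eq))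

  raise-cong : ∀ {y y′ : Fin n → ℕ} → (∀ u → y u ≡ y′ u) → ∀ v → raise y v ≡ raise y′ v
  raise-cong y≗y′ v = cong₂ (λ l p → Bool.if M * l <ᵇ N ^ slack scale + p then p else N ^ 1 + p)
                            (load-cong M a y≗y′ v) (y≗y′ v)

  1≤slack : 1 ≤ slack scale
  1≤slack = ≤-trans (s≤s z≤n) (m≤n+m 2 scale)

  N≥2 : Fin n → 2 ≤ N
  N≥2 zero    = s≤s (s≤s z≤n)
  N≥2 (suc _) = s≤s (s≤s z≤n)

  double : 2 ≤ N → ∀ j → N ^ j + N ^ j ≤ N ^ suc j
  double 2≤N j = ≤-trans (≤-reflexive (cong (N ^ j +_) (sym (+-identityʳ (N ^ j))))) (*-monoˡ-≤ (N ^ j) 2≤N)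

  -- An unraised vertex can only gain load. A raised one loses at most `N` on each edge, hence at
  -- most `N ^ slack` in `M * load`; the test has ensured that much room, so only the raise by `N`
  -- itself remains as error.
  supported : ∀ t v → potentials t v ≤ M * load M a (potentials t) v + N
  supported zero    v = ≤-trans (m∸n≤m n (toℕ v)) (≤-trans (n≤1+n n) (m≤n+m N _))
  supported (suc t) v with raise-cases (potentials t) v
  ... | inj₁ (_ , eq) = begin
    raise y v                    ≡⟨ eq ⟩
    y v                          ≤⟨ supported t v ⟩
    M * load M a y v + N         ≤⟨ +-monoˡ-≤ N (*-monoʳ-≤ M (load-mono M a y (raise y) v eq (raise-≥ y))) ⟩
    M * load M a (raise y) v + N ∎
    where
    open ≤-Reasoning
    y = potentials t
  ... | inj₂ (le , eq) = begin
    raise y v                    ≡⟨ eq ⟩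
    N ^ 1 + y v                  ≡⟨ trans (+-comm (N ^ 1) (y v)) (cong (y v +_) (*-identityʳ N)) ⟩
    y v + N                      ≤⟨ +-monoˡ-≤ N (+-cancelˡ-≤ (N ^ slack scale) _ _ enough) ⟩
    M * load M a (raise y) v + N ∎
    where
    open ≤-Reasoning
    y = potentials t
    enough : N ^ slack scale + y v ≤ N ^ slack scale + M * load M a (raise y) v
    enough = begin
      N ^ slack scale + y v
        ≤⟨ le ⟩
      M * load M a y v
        ≤⟨ *-monoʳ-≤ M (load-drop M a (N ^ 1) y (raise y) v eq (raise-≥ y)) ⟩
      M * (load M a (raise y) v + n * N ^ 1)
        ≤⟨ *-monoʳ-≤ M (+-monoʳ-≤ (load M a (raise y) v) (*-monoˡ-≤ (N ^ 1) (n≤1+n n))) ⟩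
      M * (load M a (raise y) v + N ^ 2)
        ≡⟨ trans (*-distribˡ-+ M _ (N ^ 2)) (+-comm (M * load M a (raise y) v) _) ⟩
      M * N ^ 2 + M * load M a (raise y) v
        ≡⟨ cong (_+ M * load M a (raise y) v) (sym (^-distribˡ-+-* N scale 2)) ⟩
      N ^ slack scale + M * load M a (raise y) v ∎

  -- A raise adds `N`, which is at most the slack, so the new potential is still below the
  -- `M * load` that permitted the raise.
  bounded : ∀ t v → potentials t v ≤ N ^ height scale
  bounded zero    v = ≤-trans (m∸n≤m n (toℕ v)) (≤-trans (n≤1+n n)
    (≤-trans (≤-reflexive (sym (*-identityʳ N)))
             (^-monoʳ-≤ N {1} {height scale} (≤-trans 1≤slack (m≤n+m (slack scale) scale)))))
  bounded (suc t) v with raise-cases (potentials t) v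
  ... | inj₁ (_ , eq)  = ≤-trans (≤-reflexive eq) (bounded t v)
  ... | inj₂ (le , eq) = begin
    raise y v              ≡⟨ eq ⟩
    N ^ 1 + y v            ≤⟨ +-monoˡ-≤ (y v) (^-monoʳ-≤ N {1} {slack scale} 1≤slack) ⟩
    N ^ slack scale + y v  ≤⟨ le ⟩
    M * load M a y v       ≤⟨ *-monoʳ-≤ M (load-≤ M a y v) ⟩
    M * (n * (M + M))      ≤⟨ *-monoʳ-≤ M (≤-trans (*-mono-≤ (n≤1+n n) (double (N≥2 v) scale))
                                                    (≤-reflexive (cong (N ^_) (+-comm 2 scale)))) ⟩
    M * N ^ slack scale    ≡⟨ sym (^-distribˡ-+-* N scale (slack scale)) ⟩
    N ^ height scale ∎
    where
    open ≤-Reasoning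
    y = potentials t

  residue : ∀ t v → ∃[ c ] potentials t v ≡ (n ∸ toℕ v) + c * N
  residue zero    v = 0 , sym (+-identityʳ _)
  residue (suc t) v with raise-cases (potentials t) v | residue t v
  ... | inj₁ (_ , eq) | c , ih = c , trans eq ih
  ... | inj₂ (_ , eq) | c , ih = suc c , trans eq (trans (cong₂ _+_ (*-identityʳ N) ih)
          (trans (sym (+-assoc N (n ∸ toℕ v) (c * N)))
          (trans (cong (_+ c * N) (+-comm N (n ∸ toℕ v))) (+-assoc (n ∸ toℕ v) N (c * N)))))

  injective : ∀ t {u v} → potentials t u ≡ potentials t v → u ≡ v
  injective t {u} {v} eq = Fin.toℕ-injective (∸-cancelˡ-≡ (Fin.toℕ≤n u) (Fin.toℕ≤n v) (begin
    n ∸ toℕ u            ≡⟨ sym (mod t u) ⟩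
    potentials t u % N   ≡⟨ cong (_% N) eq ⟩
    potentials t v % N   ≡⟨ mod t v ⟩
    n ∸ toℕ v            ∎))
    where
    open ≡-Reasoning
    mod : ∀ t v → potentials t v % N ≡ n ∸ toℕ v
    mod t v = trans (cong (_% N) (proj₂ (residue t v)))
             (trans ([m+kn]%n≡m%n (n ∸ toℕ v) (proj₁ (residue t v)) N)
                    (m<n⇒m%n≡m (s≤s (m∸n≤m n (toℕ v)))))

  Quiet : ℕ → Set
  Quiet t = ∀ v → potentials (suc t) v ≡ potentials t v

  quiet-suc : ∀ t → Quiet t → Quiet (suc t)
  quiet-suc t quiet = raise-cong quiet

  quiet-+ : ∀ {i} → Quiet i → ∀ d → Quiet (d + i)
  quiet-+ quiet zero    = quiet
  quiet-+ {i} quiet (suc d) = quiet-suc (d + i) (quiet-+ quiet d)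

  quiet-≥ : ∀ {i t} → Quiet i → i ≤ t → Quiet t
  quiet-≥ {i} {t} quiet i≤t = subst Quiet (m∸n+n≡m i≤t) (quiet-+ quiet (t ∸ i))

  -- Every sweep that is not quiet increases the sum of the potentials, which never exceeds
  -- `n * N ^ height`.
  eventually-quiet : ∃[ i ] i < N ^ suc (height scale) × Quiet i
  eventually-quiet with search (N ^ suc (height scale))
    where
    search : ∀ t → (∃[ i ] i < t × Quiet i) ⊎ t ≤ sum (potentials t)
    search zero    = inj₂ z≤n
    search (suc t) with search t
    ... | inj₁ (i , i<t , quiet) = inj₁ (i , m<n⇒m<1+n i<t , quiet)
    ... | inj₂ t≤ with Fin.all? (λ v → potentials (suc t) v ≟ potentials t v)
    ...   | yes quiet = inj₁ (t , ≤-refl , quiet)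
    ...   | no ¬quiet = let v , v-raised = Fin.¬∀⟶∃¬ n _ (λ v → potentials (suc t) v ≟ potentials t v) ¬quiet in
      inj₂ (≤-trans (s≤s t≤) (sum-mono-< (raise-≥ (potentials t)) v
        (≤∧≢⇒< (raise-≥ (potentials t) v) (v-raised ∘ sym))))
  ... | inj₁ found = found
  ... | inj₂ large = contradiction (≤-trans large (sum≤n*c (bounded (N ^ suc (height scale)))))
                       (<⇒≱ (*-monoˡ-< (N ^ height scale) {{m^n≢0 N (height scale)}} (n<1+n n)))

  quiet⇒< : ∀ {t} → Quiet t → ∀ v → M * load M a (potentials t) v < potentials t v + N ^ slack scale
  quiet⇒< {t} quiet v with raise-cases (potentials t) v
  ... | inj₁ (lt , _) = ≤-trans lt (≤-reflexive (+-comm (N ^ slack scale) _))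
  ... | inj₂ (_ , eq) = contradiction (trans (sym (quiet v)) eq)
                          (<⇒≢ (m<n+m (potentials t v) (m^n>0 N 1)))

  -- Once the potentials are final, whether v is selected depends on vertices of
  -- larger potential only, so that selections settle from the top down.
  selections-stable : ∀ {i} → Quiet i → ∀ r {t} → i + r ≤ t → ∀ v → N ^ height scale < potentials t v + r →
                      selections (suc t) v ≡ selections t v
  -- After `r` sweeps, exactly the potentials above `N ^ height` minus `r` are claimed to be
  -- settled; for `r` zero, `bounded` leaves none.
  selections-stable quiet zero {t} i≤t v large =
    contradiction (≤-trans large (≤-reflexive (+-identityʳ _))) (≤⇒≯ (bounded t v))
  selections-stable {i} quiet (suc r) {zero} i≤t v large = contradiction (≤-trans (m≤n+m (suc r) i) i≤t) λ ()
  selections-stable {i} quiet (suc r) {suc t} i≤t v large =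
    cong (λ d → member v ∧ (d <ᵇ k)) (sum-cong-≗ (λ u → cong (bit (a v u) *_) (same u)))
    where
    y y′ : Fin n → ℕ
    y  = potentials t
    y′ = potentials (suc t)

    i+r≤t : i + r ≤ t
    i+r≤t = s≤s⁻¹ (≤-trans (≤-reflexive (sym (+-suc i r))) i≤t)

    y′≡y : ∀ u → y′ u ≡ y u
    y′≡y = quiet-≥ quiet (≤-trans (m≤m+n i r) i+r≤t)

    same : ∀ u → above y′ (selections (suc t)) v u ≡ above y (selections t) v u
    same u with y v <? y u
    ... | yes v<u = cong₂ (λ s b → bit (s ∧ b))
      (selections-stable quiet r i+r≤t u
        (≤-trans large (≤-trans (≤-reflexive (trans (cong (_+ suc r) (y′≡y v)) (+-suc (y v) r))) (+-monoˡ-≤ r v<u))))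
      (cong₂ _<ᵇ_ (y′≡y v) (y′≡y u))
    ... | no v≮u  = trans
      (cong (λ b → bit (selections (suc t) u ∧ b))
            (trans (cong₂ _<ᵇ_ (y′≡y v) (y′≡y u)) (dec-false (y v <? y u) v≮u)))
      (trans (cong bit (trans (∧-zeroʳ (selections (suc t) u)) (sym (∧-zeroʳ (selections t u)))))
             (cong (λ b → bit (selections t u ∧ b)) (sym (dec-false (y v <? y u) v≮u))))

  y : Fin n → ℕ
  y = potentials (N ^ sweeps scale)

  S : Fin n → Bool
  S = selections (N ^ sweeps scale)

  quiet-end : Quiet (N ^ sweeps scale)
  quiet-end = let i , i< , quiet = eventually-quiet in
    quiet-≥ quiet (≤-trans (<⇒≤ i<) (^-monoʳ-≤ N {suc (height scale)} {sweeps scale} (n≤1+n (suc (height scale)))))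

  greedy : ∀ v → S v ≡ select y S v
  greedy v = let i , i< , quiet = eventually-quiet in
    -- With this many sweeps after `i`, even a vertex of potential 0 is settled.
    sym (selections-stable quiet (suc (N ^ height scale))
      (begin
        i + suc (N ^ height scale)
          ≡⟨ +-suc i (N ^ height scale) ⟩
        suc i + N ^ height scale
          ≤⟨ +-mono-≤ i< (^-monoʳ-≤ N {height scale} {suc (height scale)} (n≤1+n (height scale))) ⟩
        N ^ suc (height scale) + N ^ suc (height scale)
          ≤⟨ double (N≥2 v) (suc (height scale)) ⟩
        N ^ sweeps scale ∎)
      v (m≤n+m (suc (N ^ height scale)) (y v)))
    where open ≤-Reasoning

-- Choice of the exponent and conclusion

Fine : ℕ → Set
Fine scale = ∀ n → n * (n * (suc n + n * suc n ^ scale + suc n ^ slack scale)) < suc n ^ scale * suc n ^ scale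

-- Here the errors are `s₂ = N` and `s₁ = N ^ slack`. For `scale` 6 each of the three summands is at
-- most `N ^ 8`, and as `N` is at least 2 they add up to at most `N ^ 10`. The factors `n`
-- contribute less than `N ^ 2`, which stays below `N ^ 12`.
fine : Fine 6
fine zero        = s≤s z≤n
fine n@(suc _) = begin-strict
  n * (n * (N + n * N ^ 6 + N ^ 8))
    ≤⟨ *-monoʳ-≤ n (*-mono-≤ (n≤1+n n) (+-monoˡ-≤ (N ^ 8) (+-mono-≤ N≤N^8
         (≤-trans (*-monoˡ-≤ (N ^ 6) (n≤1+n n)) (^-monoʳ-≤ N {7} {8} (n≤1+n 7)))))) ⟩
  n * (N * (N ^ 8 + N ^ 8 + N ^ 8))
    ≤⟨ *-monoʳ-≤ n (*-monoʳ-≤ N (≤-trans (+-mono-≤ (double 8) (m≤m+n (N ^ 8) (N ^ 8)))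
         (≤-trans (+-monoʳ-≤ (N ^ 9) (double 8)) (double 9)))) ⟩
  n * N ^ 11
    <⟨ *-monoˡ-< (N ^ 11) {{m^n≢0 N 11}} (n<1+n n) ⟩
  N ^ 12
    ≡⟨ ^-distribˡ-+-* N 6 6 ⟩
  N ^ 6 * N ^ 6 ∎
  where
  open ≤-Reasoning
  N : ℕ
  N = suc n
  N≤N^8 : N ≤ N ^ 8
  N≤N^8 = ≤-trans (≤-reflexive (sym (*-identityʳ N))) (^-monoʳ-≤ N {1} {8} (s≤s z≤n))
  double : ∀ j → N ^ j + N ^ j ≤ N ^ suc j
  double j = ≤-trans (≤-reflexive (cong (N ^ j +_) (sym (+-identityʳ (N ^ j)))))
                     (*-monoˡ-≤ (N ^ j) {2} {N} (s≤s (s≤s z≤n)))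

subsetᵀ-tabᵀ : ∀ {n} (S : Subset n) → subsetᵀ S ≡ tabᵀ (boolᵀ ∘ lookup S)
subsetᵀ-tabᵀ []      = refl
subsetᵀ-tabᵀ (b ∷ S) = cong (boolᵀ b ∙_) (subsetᵀ-tabᵀ S)

listᵀ-allFin : ∀ {n} (f : Fin n → Tree) → listᵀ (List.map f (allFin n)) ≡ tabᵀ f
listᵀ-allFin f = cong listᵀ (List.map-tabulate id f)

module Solution (scale : ℕ) (fine : Fine scale) where

  term : Term 1
  term = Algorithm.algorithm scale (slack scale) (height scale) (sweeps scale)

  module _ {n} (G : Graph n) (k : ℕ) where
    open Convergence scale (adjacent G) (lookup (V G)) k

    solution : Subset n
    solution = tabulate S

    solution-splits : .{{_ : NonZero k}} → [ fromℕ k ] ≤₋ mad G → Splits G k solution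
    solution-splits =
      splits G k M (N ^ slack scale) N y S (quiet⇒< {N ^ sweeps scale} quiet-end) (supported (N ^ sweeps scale))
             (injective (N ^ sweeps scale)) greedy (fine n)

    graphᵀ≡ : graphᵀ G ≡ graph
    graphᵀ≡ = cong₂ _∙_ (subsetᵀ-tabᵀ (V G))
                        (trans (listᵀ-allFin (λ v → listᵀ (List.map (boolᵀ ∘ adjacent G v) (allFin n))))
                               (tabᵀ-cong (λ v → listᵀ-allFin (boolᵀ ∘ adjacent G v))))

    output≡ : ⟦ term ⟧ (graphᵀ G) ((graphᵀ G ∙ natᵀ k) ∷ []) ≡ subsetᵀ solution
    output≡ = trans (cong (λ C → ⟦ term ⟧ C ((C ∙ natᵀ k) ∷ [])) graphᵀ≡)
             (trans (⟦algorithm⟧ bounded)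
                    (sym (trans (subsetᵀ-tabᵀ solution) (tabᵀ-cong (λ v → cong boolᵀ (lookup∘tabulate S v))))))

theorem1 : (∀ {n} (G : Graph n) (k : ℕ) .{{_ : NonZero k}} → [ fromℕ k ] ≤₋ mad G →
    ∃[ S ] Splits G k S)
    ×
    (∃[ P ] ∃[ c ] ∃[ d ]
    (∀ {n} (G : Graph n) (k : ℕ) .{{_ : NonZero k}} → [ fromℕ k ] ≤₋ mad G →
    ∃[ S ] Splits G k S
    × ∃[ t ] (P ⟦ graphᵀ G ∙ natᵀ k ⟧⇓ subsetᵀ S [ t ])
    × t ≤ c * size (graphᵀ G) ^ d))
theorem1 =
  (λ G k k≤mad → solution G k , solution-splits G k k≤mad) ,
  (let c , d , runs = program-poly term in
   compileProgram term , c , d ,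
   λ G k k≤mad →
     let t , run , t≤ = runs (graphᵀ G) (natᵀ k) in
     solution G k , solution-splits G k k≤mad , t ,
     subst (λ o → compileProgram term ⟦ graphᵀ G ∙ natᵀ k ⟧⇓ o [ t ]) (output≡ G k) run , t≤)
  where open Solution 6 fine
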